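{- Let $\alpha$ be a composition and $\mu$ a partition, and suppose that in the ring of quasisymmetric functions in $x_1,x_2,\dots$ $$\mathcal{CS}_\alpha\, s_\mu=\sum_{\beta:\ \alpha\subseteq\beta}A^{\beta}_{\alpha\mu}\,\mathcal{CS}_\beta .$$ Then for all $k,l\ge0$, $$\mathcal{HQ}_\alpha(X;Y)\,HS_\mu(X;Y)=\sum_{\beta:\ \alpha\subseteq\beta}A^{\beta}_{\alpha\mu}\,\mathcal{HQ}_\beta(X;Y).$$
   Context: French notation: row $i$ is the $i$-th from the bottom, cell $(i,j)$ is row $i$, column $j$; a composition $\beta=(\beta_1,\dots,\beta_r)$ with largest part $m$ has $\beta_i$ cells in row $i$. $\alpha\subseteq\beta$ means $\ell(\alpha)\le\ell(\beta)$ and $\alpha_i\le\beta_i$ for $i\le\ell(\alpha)$. For a filling $F$ of $\beta$, $\hat F$ is the $r\times m$ array with $\infty$ (larger than everything) in the missing cells. A semistandard Young composition tableau (SSYCT) of shape $\beta$ is a filling $T$ with positive integers such that rows weakly increase left to right, the leftmost column strictly increases bottom to top, and for $1\le i<j\le r$, $1\le n<m$: if $\hat T(i,n+1)\ne\infty$ and $\hat T(i,n+1)\ge\hat T(j,n)$ then $\hat T(i,n+1)>\hat T(j,n+1)$. $\mathcal{CS}_\beta=\sum_T x^T$ over SSYCT $T$ of shape $\beta$, where $x^T=\prod_i x_i^{\#\{\text{entries } i\}}$. $s_\mu$ is the Schur function. Fix $k,l\ge0$, $\mathcal{A}=\{1,\dots,k\}$, $\mathcal{A}'=\{1',\dots,l'\}$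 ordered $1<\dots<k<1'<\dots<l'$, $X=(x_1,\dots,x_k)$, $Y=(y_1,\dots,y_l)$. A semistandard hook tableau (SSHT) of partition shape $\mu$ is a filling of the Young diagram of $\mu$ with letters of $\mathcal{A}\cup\mathcal{A}'$ with all rows and columns weakly increasing, unprimed entries weakly increasing along rows and strictly up columns, primed entries strictly increasing along rows and weakly up columns; $HS_\mu(X;Y)=\sum_T\prod x_i^{v_i}\prod y_i^{u_i}$ over SSHT of shape $\mu$, with $v_i,u_i$ the numbers of entries $i$, $i'$. A hook composition tableau (HCT) of shape $\beta$ is a filling $F$ with letters of $\mathcal{A}\cup\mathcal{A}'$ such that rows weakly increase; unprimed entries weakly and primed strictly increase along rows; in the leftmost column unprimed entries strictly and primed weakly increase bottom to top; and for $1\le i<j\le r$, $1\le n<m$: (a) if $\hat F(i,n+1)\in\mathcal{A}$ and $\hat F(i,n+1)\ge\hat F(j,n)$ then $\hat F(i,n+1)>\hat F(j,n+1)$; (b) if $\hat F(i,n+1)\in\mathcal{A}'$ and $\hat F(i,n+1)>\hat F(j,n)$ then $\hat F(i,n+1)\ge\hat F(j,n+1)$. $\mathcal{HQ}_\beta(X;Y)=\sum_F\prod x_i^{v_i}\prod y_i^{u_i}$ over HCT of shape $\beta$. -}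

module Defs where

open import Data.Nat using (ℕ; zero; suc; _+_; _∸_; _⊔_; _<_; _≥_; _≤ᵇ_; _<ᵇ_; _≡ᵇ_)
open import Data.Bool using (Bool; true; false; _∧_; _∨_; not; if_then_else_)
open import Data.List using (List; []; _∷_; length; map; concatMap; upTo; foldr; filterᵇ; zip; _++_)
open import Data.Nat.ListAction using (sum)
open import Data.List.Relation.Unary.All using (All)
open import Data.List.Relation.Unary.Linked using (Linked)
open import Data.Maybe using (Maybe; just; nothing)
open import Data.Product using (_×_; _,_)
open import Data.Integer as ℤ using (ℤ)

-- a composition: list of positive parts (row i = i-th from the bottom)
IsComposition : List ℕ → Set
IsComposition α = All (λ p → 0 < p) α

IsPartition : List ℕ → Set
IsPartition μ = IsComposition μ × Linked _≥_ μ

_⊆ᵇ_ : List ℕ → List ℕ → Bool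
[] ⊆ᵇ _ = true
(a ∷ α) ⊆ᵇ [] = false
(a ∷ α) ⊆ᵇ (b ∷ β) = (a ≤ᵇ b) ∧ (α ⊆ᵇ β)

all : {A : Set} → (A → Bool) → List A → Bool
all p = foldr (λ x b → p x ∧ b) true

range1 : ℕ → List ℕ
range1 n = map suc (upTo n)

rangeFrom : ℕ → ℕ → List ℕ
rangeFrom a b = map (a +_) (upTo (b ∸ a))

words : {A : Set} → List A → ℕ → List (List A)
words alph zero = [] ∷ []
words alph (suc p) = concatMap (λ a → map (a ∷_) (words alph p)) alph

fillings : {A : Set} → List A → List ℕ → List (List (List A))
fillings alph = foldr (λ p acc → concatMap (λ w → map (w ∷_) acc) (words alph p)) ([] ∷ [])

nth : {A : Set} → List A → ℕ → Maybe A
nth [] _ = nothing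
nth (x ∷ xs) zero = just x
nth (x ∷ xs) (suc n) = nth xs n

-- F̂(i,c) with 0-indexed row i (from the bottom) and column c; nothing = ∞
hat : {A : Set} → List (List A) → ℕ → ℕ → Maybe A
hat F i c with nth F i
... | nothing = nothing
... | just row = nth row c

adjPairs : {A : Set} → List A → List (A × A)
adjPairs [] = []
adjPairs (x ∷ []) = []
adjPairs (x ∷ y ∷ xs) = (x , y) ∷ adjPairs (y ∷ xs)

heads : {A : Set} → List (List A) → List A
heads [] = []
heads ([] ∷ rs) = heads rs
heads ((x ∷ _) ∷ rs) = x ∷ heads rs

maxLen : {A : Set} → List (List A) → ℕ
maxLen F = foldr _⊔_ 0 (map length F)

-- the "triple" condition: for all rows i < j < r and 1 ≤ n < m
-- (0-indexed columns c = n-1 and c+1), cond F̂(i,n+1) F̂(j,n) F̂(j,n+1)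
tripleOK : {A : Set} → (Maybe A → Maybe A → Maybe A → Bool) → List (List A) → Bool
tripleOK cond F =
  all (λ i → all (λ j → all (λ c → cond (hat F i (suc c)) (hat F j c) (hat F j (suc c)))
                                 (upTo (maxLen F ∸ 1)))
                  (rangeFrom (suc i) (length F)))
      (upTo (length F))

count : {A : Set} → (A → Bool) → List (List A) → ℕ
count p F = sum (map (λ row → length (filterᵇ p row)) F)

eqListᵇ : List ℕ → List ℕ → Bool
eqListᵇ [] [] = true
eqListᵇ (a ∷ as) (b ∷ bs) = (a ≡ᵇ b) ∧ eqListᵇ as bs
eqListᵇ _ _ = false

sumℤ : List ℤ → ℤ
sumℤ = foldr ℤ._+_ (ℤ.+ 0)

splits : List ℕ → List (List ℕ × List ℕ)
splits [] = ([] , []) ∷ []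
splits (a ∷ v) = concatMap (λ i → map (λ { (p , q) → (i ∷ p , (a ∸ i) ∷ q) }) (splits v)) (upTo (suc a))

compositionsOf : ℕ → List (List ℕ)
compositionsOf d = filterᵇ (λ β → sum β ≡ᵇ d) (concatMap (words (range1 d)) (upTo (suc d)))

-- Power series in x₁, x₂, … are represented by their coefficient functions:
-- for v : List ℕ, the coefficient of x₁^{v₁} ⋯ x_n^{v_n} (n = length v,
-- all other exponents 0).

-- Hat comparisons on ℕ ∪ {∞} (nothing = ∞)
_≥ₘ_ : ℕ → Maybe ℕ → Bool
a ≥ₘ nothing = false
a ≥ₘ just b = b ≤ᵇ a

_>ₘ_ : ℕ → Maybe ℕ → Bool
a >ₘ nothing = false
a >ₘ just b = b <ᵇ a

weakRow : List ℕ → Bool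
weakRow w = all (λ { (a , b) → a ≤ᵇ b }) (adjPairs w)

strictList : List ℕ → Bool
strictList w = all (λ { (a , b) → a <ᵇ b }) (adjPairs w)

ssyctTriple : Maybe ℕ → Maybe ℕ → Maybe ℕ → Bool
ssyctTriple nothing _ _ = true
ssyctTriple (just a) b c = if a ≥ₘ b then a >ₘ c else true

-- semistandard Young composition tableau (entries are positive by enumeration)
isSSYCT : List (List ℕ) → Bool
isSSYCT T = all weakRow T ∧ strictList (heads T) ∧ tripleOK ssyctTriple T

contentℕ : ℕ → List (List ℕ) → List ℕ
contentℕ n T = map (λ i → count (λ e → e ≡ᵇ i) T) (range1 n)

csCoeff : List ℕ → List ℕ → ℤ
csCoeff β v = ℤ.+ length (filterᵇ (λ T → isSSYCT T ∧ eqListᵇ (contentℕ (length v) T) v)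
                                   (fillings (range1 (length v)) β))

-- semistandard Young tableau of partition shape (French): rows weakly
-- increase, columns strictly increase bottom to top
colStrict : List ℕ → List ℕ → Bool
colStrict lower upper = all (λ { (a , b) → a <ᵇ b }) (zip lower upper)

isSSYT : List (List ℕ) → Bool
isSSYT T = all weakRow T ∧ all (λ { (lo , up) → colStrict lo up }) (adjPairs T)

schurCoeff : List ℕ → List ℕ → ℤ
schurCoeff μ v = ℤ.+ length (filterᵇ (λ T → isSSYT T ∧ eqListᵇ (contentℕ (length v) T) v)
                                      (fillings (range1 (length v)) μ))

prodCS : List ℕ → List ℕ → List ℕ → ℤ
prodCS α μ v = sumℤ (map (λ { (p , q) → csCoeff α p ℤ.* schurCoeff μ q }) (splits v))

-- coefficient of x^v in Σ_{β ⊇ α} A^β CS_β (only β with |β| = |v| contribute)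
sumCS : List ℕ → (List ℕ → ℤ) → List ℕ → ℤ
sumCS α A v = sumℤ (map (λ β → A β ℤ.* csCoeff β v)
                        (filterᵇ (α ⊆ᵇ_) (compositionsOf (sum v))))

-- Hook alphabet 1 < … < k < 1' < … < l'

data HL : Set where
  un : ℕ → HL   -- unprimed i
  pr : ℕ → HL   -- primed i'

isUn : HL → Bool
isUn (un _) = true
isUn (pr _) = false

isPr : HL → Bool
isPr x = not (isUn x)

_≤L_ : HL → HL → Bool
un a ≤L un b = a ≤ᵇ b
un _ ≤L pr _ = true
pr _ ≤L un _ = false
pr a ≤L pr b = a ≤ᵇ b

_<L_ : HL → HL → Bool
un a <L un b = a <ᵇ b
un _ <L pr _ = true
pr _ <L un _ = false
pr a <L pr b = a <ᵇ b

_=L_ : HL → HL → Bool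
un a =L un b = a ≡ᵇ b
pr a =L pr b = a ≡ᵇ b
_ =L _ = false

_≥L∞_ : HL → Maybe HL → Bool
a ≥L∞ nothing = false
a ≥L∞ just b = b ≤L a

_>L∞_ : HL → Maybe HL → Bool
a >L∞ nothing = false
a >L∞ just b = b <L a

alphabet : ℕ → ℕ → List HL
alphabet k l = map un (range1 k) ++ map pr (range1 l)

rowPair : HL → HL → Bool
rowPair a b = (a <L b) ∨ ((a =L b) ∧ isUn a)

-- column condition (a below b): weakly increasing, unprimed strictly, primed weakly
colPair : HL → HL → Bool
colPair a b = (a <L b) ∨ ((a =L b) ∧ isPr a)

hookRow : List HL → Bool
hookRow w = all (λ { (a , b) → rowPair a b }) (adjPairs w)

hctTriple : Maybe HL → Maybe HL → Maybe HL → Bool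
hctTriple nothing _ _ = true
hctTriple (just (un a)) b c = if un a ≥L∞ b then un a >L∞ c else true
hctTriple (just (pr a)) b c = if pr a >L∞ b then pr a ≥L∞ c else true

isHCT : List (List HL) → Bool
isHCT F = all hookRow F
        ∧ all (λ { (a , b) → colPair a b }) (adjPairs (heads F))
        ∧ tripleOK hctTriple F

isSSHT : List (List HL) → Bool
isSSHT T = all hookRow T
         ∧ all (λ { (lo , up) → all (λ { (a , b) → colPair a b }) (zip lo up) }) (adjPairs T)

hookContentOK : List ℕ → List ℕ → List (List HL) → Bool
hookContentOK v u F =
  eqListᵇ (map (λ i → count (λ e → un i =L e) F) (range1 (length v))) v
  ∧ eqListᵇ (map (λ i → count (λ e → pr i =L e) F) (range1 (length u))) u

-- coefficient of x^v y^u in HQ_β(X;Y), where k = length v, l = length u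
hqCoeff : List ℕ → List ℕ → List ℕ → ℤ
hqCoeff β v u = ℤ.+ length (filterᵇ (λ F → isHCT F ∧ hookContentOK v u F)
                                     (fillings (alphabet (length v) (length u)) β))

hsCoeff : List ℕ → List ℕ → List ℕ → ℤ
hsCoeff μ v u = ℤ.+ length (filterᵇ (λ T → isSSHT T ∧ hookContentOK v u T)
                                     (fillings (alphabet (length v) (length u)) μ))

prodHQ : List ℕ → List ℕ → List ℕ → List ℕ → ℤ
prodHQ α μ v u =
  sumℤ (concatMap (λ { (v₁ , v₂) → map (λ { (u₁ , u₂) → hqCoeff α v₁ u₁ ℤ.* hsCoeff μ v₂ u₂ }) (splits u) })
                  (splits v))

-- coefficient of x^v y^u in Σ_{β ⊇ α} A^β HQ_β (only |β| = |v|+|u| contribute)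
sumHQ : List ℕ → (List ℕ → ℤ) → List ℕ → List ℕ → ℤ
sumHQ α A v u = sumℤ (map (λ β → A β ℤ.* hqCoeff β v u)
                          (filterᵇ (α ⊆ᵇ_) (compositionsOf (sum v + sum u))))

{-# OPTIONS --safe #-}

-- A coefficient function P v u of x^v y^u is determined by its values at u = []
-- once it ignores zero exponents at the end of v and at the start of u and the
-- substitution y₁ = - x_{k+1} eliminates both variables: this expresses the
-- coefficients with first primed exponent a > 0 by those with a smaller one.
-- Such supersymmetric functions are closed under products and linear
-- combinations, and for u = [] the claim is the given identity for CS and s.
--
-- HQ_β and HS_μ are supersymmetric by a sign-reversing involution.  Let R be the
-- set of cells containing x = k+1 or y = 1'.  In one distinguished cell of the
-- rightmost column meeting R the letters x and y can always be exchanged: the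
-- lowest cell of R in that column, except that for an HCT it is the highest one
-- unless the column is the leftmost.
module Submission where

open import Defs
open import Data.Nat using (ℕ)
open import Data.List using (List)
open import Data.Vec using (Vec; toList)
open import Data.Integer using (ℤ)
open import Relation.Binary.PropositionalEquality using (_≡_)

open import Data.Bool using (Bool; true; false; _∧_; _∨_; if_then_else_; T)
open import Data.Bool.Properties using (T?; ∧-assoc; ∧-comm; ∧-identityʳ)
open import Data.Empty using (⊥-elim)
open import Data.Integer as ℤ using (+_; -_)
import Data.Integer.Properties as ℤ
import Algebra.Properties.AbelianGroup ℤ.+-0-abelianGroup as ℤGroup
import Data.Integer.Tactic.RingSolver as ℤSolver
open import Data.List using
  ([]; _∷_; length; map; concatMap; upTo; filterᵇ; zip; _++_; cartesianProductWith)
open import Data.List.Membership.Propositional using (_∈_; find)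
import Data.List.Membership.Propositional.Properties as Mem
import Data.List.Properties as List
open import Data.List.Relation.Unary.All as All using (All; []; _∷_)
import Data.List.Relation.Unary.All.Properties as All
open import Data.List.Relation.Unary.Any using (here; there)
open import Data.List.Relation.Unary.AllPairs using ([]; _∷_)
open import Data.List.Relation.Unary.Unique.Propositional using (Unique)
import Data.List.Relation.Unary.Unique.Propositional.Properties as Unique
open import Data.Maybe as Maybe using (Maybe; just; nothing)
open import Data.Maybe.Relation.Unary.All as MAll using (just; nothing)
import Data.Maybe.Properties as Maybe
open import Data.Nat as ℕ using (zero; suc; _+_; _∸_; _≤_; _<_; z≤n; s≤s; _≤ᵇ_; _<ᵇ_; _≡ᵇ_)
open import Data.Nat.ListAction using (sum)
open import Data.Nat.ListAction.Properties using (sum-++)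
import Data.Nat.Properties as ℕ
import Algebra.Properties.CommutativeSemigroup ℕ.+-commutativeSemigroup as ℕ+
open import Data.Product using (∃; _×_; _,_; proj₁; proj₂)
open import Data.Sum using (_⊎_; inj₁; inj₂)
open import Data.Unit using (tt)
open import Function using (_∘_; id)
open import Relation.Nullary using (¬_; yes; no)
open import Relation.Binary.PropositionalEquality
  using (_≢_; refl; sym; trans; cong; cong₂; subst; module ≡-Reasoning)

-- In the alphabet at hand x = k+1 is the last unprimed letter and y = 1' the first primed one, so
-- every other letter compares alike with both. Exchanging them in one cell can therefore disturb
-- only conditions that involve a second cell of R. Along rows the rightmost cell of R is free. In
-- columns the lowest one is free, since any cell of R directly above a cell of R must contain y.
-- The triples pull the other way: conditions (a) at x and (b) at y have equivalent premises on
-- F̂(j,n), but their conclusions differ exactly when F̂(j,n+1) lies in R, so a cell in the role of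
-- F̂(i,n+1) must have no cell of R above it. The two demands never meet, because the column
-- condition of an HCT concerns the leftmost column only, and F̂(i,n+1) never lies in that column.
-- Lowering the exponent of y₁ raises that of an additional variable x_{k+1}. No fixed k is closed
-- under this recursion, so coefficient functions take exponent lists of all lengths at once.

private variable
  X Y Z : Set

-- Finite sums and convolutions

opaque
  ∑ : List X → (X → ℤ) → ℤ
  ∑ xs f = sumℤ (map f xs)

  ∑-[] : (f : X → ℤ) → ∑ [] f ≡ + 0
  ∑-[] f = refl

  ∑-∷ : (x : X) (xs : List X) (f : X → ℤ) → ∑ (x ∷ xs) f ≡ f x ℤ.+ ∑ xs f
  ∑-∷ x xs f = refl

  sumℤ-map : (f : X → ℤ) (xs : List X) → sumℤ (map f xs) ≡ ∑ xs f
  sumℤ-map f xs = refl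

  ∑-cong : (xs : List X) {f g : X → ℤ} → (∀ x → x ∈ xs → f x ≡ g x) → ∑ xs f ≡ ∑ xs g
  ∑-cong [] eq = refl
  ∑-cong (x ∷ xs) eq = cong₂ ℤ._+_ (eq x (here refl)) (∑-cong xs λ y → eq y ∘ there)

  ∑-++ : (xs ys : List X) {f : X → ℤ} → ∑ (xs ++ ys) f ≡ ∑ xs f ℤ.+ ∑ ys f
  ∑-++ [] ys = sym (ℤ.+-identityˡ _)
  ∑-++ (x ∷ xs) ys {f} =
    trans (cong (ℤ._+_ (f x)) (∑-++ xs ys)) (sym (ℤ.+-assoc (f x) (∑ xs f) (∑ ys f)))

  ∑-map : (h : X → Y) (xs : List X) {f : Y → ℤ} → ∑ (map h xs) f ≡ ∑ xs (f ∘ h)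
  ∑-map h xs = cong sumℤ (sym (List.map-∘ xs))

  ∑-concatMap : (h : X → List Y) (xs : List X) {f : Y → ℤ} →
    ∑ (concatMap h xs) f ≡ ∑ xs (λ x → ∑ (h x) f)
  ∑-concatMap h [] = refl
  ∑-concatMap h (x ∷ xs) {f} =
    trans (∑-++ (h x) (concatMap h xs)) (cong (ℤ._+_ (∑ (h x) f)) (∑-concatMap h xs))

  sumℤ-concatMap : (h : X → List ℤ) (xs : List X) → sumℤ (concatMap h xs) ≡ ∑ xs (sumℤ ∘ h)
  sumℤ-concatMap h xs =
    trans (cong sumℤ (sym (List.map-id (concatMap h xs))))
      (trans (∑-concatMap h xs) (∑-cong xs λ x _ → cong sumℤ (List.map-id (h x))))

  ∑-+ : (xs : List X) {f g : X → ℤ} → ∑ xs (λ x → f x ℤ.+ g x) ≡ ∑ xs f ℤ.+ ∑ xs g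
  ∑-+ [] = refl
  ∑-+ (x ∷ xs) {f} {g} =
    trans (cong (λ s → f x ℤ.+ g x ℤ.+ s) (∑-+ xs)) (interchange (f x) (g x) (∑ xs f) (∑ xs g))
    where
    interchange : ∀ a b c d → a ℤ.+ b ℤ.+ (c ℤ.+ d) ≡ a ℤ.+ c ℤ.+ (b ℤ.+ d)
    interchange = ℤSolver.solve-∀

  ∑-*ˡ : (c : ℤ) (xs : List X) {f : X → ℤ} → ∑ xs (λ x → c ℤ.* f x) ≡ c ℤ.* ∑ xs f
  ∑-*ˡ c [] = sym (ℤ.*-zeroʳ c)
  ∑-*ˡ c (x ∷ xs) {f} =
    trans (cong (ℤ._+_ (c ℤ.* f x)) (∑-*ˡ c xs)) (sym (ℤ.*-distribˡ-+ c (f x) (∑ xs f)))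

  ∑-neg : (xs : List X) {f : X → ℤ} → ∑ xs (λ x → - f x) ≡ - ∑ xs f
  ∑-neg [] = refl
  ∑-neg (x ∷ xs) {f} =
    trans (cong (ℤ._+_ (- f x)) (∑-neg xs)) (sym (ℤ.neg-distrib-+ (f x) (∑ xs f)))

  ∑-0 : (xs : List X) → ∑ xs (λ _ → + 0) ≡ + 0
  ∑-0 [] = refl
  ∑-0 (x ∷ xs) = trans (ℤ.+-identityˡ _) (∑-0 xs)

≡-neg⇒≡0 : ∀ i → i ≡ - i → i ≡ + 0
≡-neg⇒≡0 (+ zero) _ = refl
≡-neg⇒≡0 (+ suc n) ()
≡-neg⇒≡0 (ℤ.-[1+ n ]) ()

𝟙 : Bool → ℤ
𝟙 b = if b then + 1 else + 0

opaque
  unfolding ∑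

  length-filter : (p : X → Bool) (xs : List X) → + length (filterᵇ p xs) ≡ ∑ xs (𝟙 ∘ p)
  length-filter p [] = refl
  length-filter p (x ∷ xs) with p x
  ... | true = cong (ℤ._+_ (+ 1)) (length-filter p xs)
  ... | false = trans (length-filter p xs) (sym (ℤ.+-identityˡ _))

opaque
  -- The convolution sum over i + j = a. Both indices are passed to `φ`, which keeps the truncated
  -- difference `a ∸ i` out of the algebra below.
  C : ℕ → (ℕ → ℕ → ℤ) → ℤ
  C zero φ = φ 0 0
  C (suc a) φ = φ 0 (suc a) ℤ.+ C a (φ ∘ suc)

  C-zero : ∀ φ → C zero φ ≡ φ 0 0
  C-zero φ = refl

  C-suc : ∀ a φ → C (suc a) φ ≡ φ 0 (suc a) ℤ.+ C a (φ ∘ suc)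
  C-suc a φ = refl

opaque
  unfolding C

  C-upTo : ∀ a φ → ∑ (upTo (suc a)) (λ i → φ i (a ∸ i)) ≡ C a φ
  C-upTo zero φ = trans (∑-∷ 0 [] _) (trans (cong (ℤ._+_ (φ 0 0)) (∑-[] _)) (ℤ.+-identityʳ _))
  C-upTo (suc a) φ = trans (∑-∷ 0 _ _) (cong (ℤ._+_ (φ 0 (suc a)))
    (trans (cong (λ is → ∑ is λ i → φ i (suc a ∸ i)) (sym (List.map-upTo suc (suc a))))
      (trans (∑-map suc (upTo (suc a))) (C-upTo a (φ ∘ suc)))))

opaque
  unfolding C

  C-cong : ∀ a {φ ψ} → (∀ i j → i + j ≡ a → φ i j ≡ ψ i j) → C a φ ≡ C a ψ
  C-cong zero eq = eq 0 0 refl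
  C-cong (suc a) eq =
    cong₂ ℤ._+_ (eq 0 (suc a) refl) (C-cong a λ i j i+j≡a → eq (suc i) j (cong suc i+j≡a))

C-+ : ∀ a {φ ψ} → C a (λ i j → φ i j ℤ.+ ψ i j) ≡ C a φ ℤ.+ C a ψ
C-+ a {φ} {ψ} = trans (sym (C-upTo a _)) (trans (∑-+ (upTo (suc a))) (cong₂ ℤ._+_ (C-upTo a φ) (C-upTo a ψ)))

C-*ˡ : ∀ c a {φ} → C a (λ i j → c ℤ.* φ i j) ≡ c ℤ.* C a φ
C-*ˡ c a {φ} = trans (sym (C-upTo a _)) (trans (∑-*ˡ c (upTo (suc a))) (cong (c ℤ.*_) (C-upTo a φ)))

C-neg : ∀ a {φ} → C a (λ i j → - φ i j) ≡ - C a φ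
C-neg a {φ} = trans (sym (C-upTo a _)) (trans (∑-neg (upTo (suc a))) (cong -_ (C-upTo a φ)))

C-0 : ∀ a → C a (λ _ _ → + 0) ≡ + 0
C-0 a = trans (sym (C-upTo a _)) (∑-0 (upTo (suc a)))

opaque
  unfolding ∑

  C-∑ : ∀ a (xs : List X) {φ : X → ℕ → ℕ → ℤ} →
    C a (λ i j → ∑ xs (λ x → φ x i j)) ≡ ∑ xs (λ x → C a (φ x))
  C-∑ a [] = C-0 a
  C-∑ a (x ∷ xs) {φ} = trans (C-+ a) (cong (ℤ._+_ (C a (φ x))) (C-∑ a xs))

opaque
  unfolding C

  C-snoc : ∀ a φ → C (suc a) φ ≡ C a (λ i → φ i ∘ suc) ℤ.+ φ (suc a) 0
  C-snoc zero φ = refl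
  C-snoc (suc a) φ =
    trans (cong (ℤ._+_ (φ 0 (suc (suc a)))) (C-snoc a (φ ∘ suc)))
      (sym (ℤ.+-assoc (φ 0 (suc (suc a))) (C a (λ i j → φ (suc i) (suc j))) (φ (suc (suc a)) 0)))

  C-comm : ∀ a φ → C a φ ≡ C a (λ i j → φ j i)
  C-comm zero φ = refl
  C-comm (suc a) φ =
    trans (cong (ℤ._+_ (φ 0 (suc a))) (C-comm a (φ ∘ suc)))
      (trans (ℤ.+-comm (φ 0 (suc a)) _) (sym (C-snoc a (λ i j → φ j i))))

  -- Both sides range over all i + j + k = a.
  C-assoc : ∀ a (φ : ℕ → ℕ → ℕ → ℤ) →
    C a (λ s k → C s (λ i j → φ i j k)) ≡ C a (λ i t → C t (φ i))
  C-assoc zero φ = refl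
  C-assoc (suc a) φ =
    trans (cong (ℤ._+_ (φ 0 0 (suc a))) (trans (C-+ a) (cong (ℤ._+_ (C a (φ 0 ∘ suc))) (C-assoc a (φ ∘ suc)))))
      (sym (ℤ.+-assoc (φ 0 0 (suc a)) (C a (φ 0 ∘ suc)) (C a (λ i t → C t (φ (suc i))))))

-- Both sides range over all i + j + k + l = a. For products this passes from grouping by variable
-- (x-exponents, y-exponents) to grouping by factor.
C-interchange : ∀ a (φ : ℕ → ℕ → ℕ → ℕ → ℤ) →
  C a (λ m n → C m (λ i j → C n (λ k l → φ i j k l))) ≡
  C a (λ m n → C m (λ i k → C n (λ j l → φ i j k l)))
C-interchange a φ = begin
  C a (λ m n → C m (λ i j → C n (φ i j)))
    ≡⟨ C-assoc a (λ i j n → C n (φ i j)) ⟩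
  C a (λ i t → C t (λ j n → C n (φ i j)))
    ≡⟨ C-cong a (λ i t _ → swap i t) ⟩
  C a (λ i t → C t (λ k n → C n (λ j → φ i j k)))
    ≡⟨ C-assoc a (λ i k n → C n (λ j → φ i j k)) ⟨
  C a (λ m n → C m (λ i k → C n (λ j l → φ i j k l))) ∎
  where
  open ≡-Reasoning
  swap : ∀ i t → C t (λ j n → C n (φ i j)) ≡ C t (λ k n → C n (λ j → φ i j k))
  swap i t =
    trans (sym (C-assoc t (φ i)))
      (trans (C-cong t λ s l _ → C-comm s (λ j k → φ i j k l)) (C-assoc t λ k j → φ i j k))

C-*-C : ∀ m n (φ ψ : ℕ → ℕ → ℤ) →
  C m (λ i j → C n (λ k l → φ i j ℤ.* ψ k l)) ≡ C m φ ℤ.* C n ψ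
C-*-C m n φ ψ = begin
  C m (λ i j → C n (λ k l → φ i j ℤ.* ψ k l)) ≡⟨ C-cong m (λ i j _ → C-*ˡ (φ i j) n) ⟩
  C m (λ i j → φ i j ℤ.* C n ψ)                ≡⟨ C-cong m (λ i j _ → ℤ.*-comm (φ i j) (C n ψ)) ⟩
  C m (λ i j → C n ψ ℤ.* φ i j)                ≡⟨ C-*ˡ (C n ψ) m ⟩
  C n ψ ℤ.* C m φ                              ≡⟨ ℤ.*-comm (C n ψ) (C m φ) ⟩
  C m φ ℤ.* C n ψ                              ∎
  where open ≡-Reasoning

S : List ℕ → (List ℕ → List ℕ → ℤ) → ℤ
S v f = ∑ (splits v) (λ p → f (proj₁ p) (proj₂ p))

S-cong : ∀ v {f g} → (∀ p q → f p q ≡ g p q) → S v f ≡ S v g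
S-cong v eq = ∑-cong (splits v) λ p _ → eq (proj₁ p) (proj₂ p)

S-[] : ∀ f → S [] f ≡ f [] []
S-[] f = trans (∑-∷ _ [] _) (trans (cong (ℤ._+_ (f [] [])) (∑-[] _)) (ℤ.+-identityʳ _))

S-∷ : ∀ a v f → S (a ∷ v) f ≡ C a (λ i j → S v (λ p q → f (i ∷ p) (j ∷ q)))
S-∷ a v f =
  trans (∑-concatMap _ (upTo (suc a)))
    (trans (∑-cong (upTo (suc a)) λ i _ → trans (∑-map _ (splits v)) (∑-cong (splits v) λ { (p , q) _ → refl }))
      (C-upTo a λ i j → S v (λ p q → f (i ∷ p) (j ∷ q))))

-- `splits` recurses at the front of the list, whereas the variable x_{k+1} to be cancelled is the
-- last entry of the exponent list.
S-snoc : ∀ v a f → S (v ++ a ∷ []) f ≡ S v (λ p q → C a (λ i j → f (p ++ i ∷ []) (q ++ j ∷ [])))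
S-snoc [] a f =
  trans (S-∷ a [] f) (trans (C-cong a λ i j _ → S-[] _) (sym (S-[] _)))
S-snoc (b ∷ v) a f = begin
  S (b ∷ v ++ a ∷ []) f
    ≡⟨ S-∷ b (v ++ a ∷ []) f ⟩
  C b (λ i j → S (v ++ a ∷ []) (λ p q → f (i ∷ p) (j ∷ q)))
    ≡⟨ C-cong b (λ i j _ → S-snoc v a _) ⟩
  C b (λ i j → S v (λ p q → C a (λ i′ j′ → f (i ∷ p ++ i′ ∷ []) (j ∷ q ++ j′ ∷ []))))
    ≡⟨ S-∷ b v _ ⟨
  S (b ∷ v) (λ p q → C a (λ i j → f (p ++ i ∷ []) (q ++ j ∷ []))) ∎
  where open ≡-Reasoning

C-S : ∀ a v {φ : ℕ → ℕ → List ℕ → List ℕ → ℤ} →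
  C a (λ i j → S v (φ i j)) ≡ S v (λ p q → C a (λ i j → φ i j p q))
C-S a v = C-∑ a (splits v)

-- Supersymmetric coefficient functions

-- In `cancel` the sign goes with the exponent of x_{k+1} instead of that of y₁. For a fixed total
-- degree the two conventions differ by a constant factor, so the vanishing is the same.
sgn : ℕ → ℤ
sgn zero = + 1
sgn (suc i) = - sgn i

sgn-+ : ∀ i j → sgn (i + j) ≡ sgn i ℤ.* sgn j
sgn-+ zero j = sym (ℤ.*-identityˡ (sgn j))
sgn-+ (suc i) j = trans (cong -_ (sgn-+ i j)) (ℤ.neg-distribˡ-* (sgn i) (sgn j))

-- The last field is the vanishing of the coefficient of x_{k+1}^{a+1} after y₁ = - x_{k+1}.
record IsSuper (P : List ℕ → List ℕ → ℤ) : Set where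
  field
    drop-x : ∀ v u → P (v ++ 0 ∷ []) u ≡ P v u
    drop-y : ∀ v u → P v (0 ∷ u) ≡ P v u
    cancel : ∀ a v u → C (suc a) (λ i j → sgn i ℤ.* P (v ++ i ∷ []) (j ∷ u)) ≡ + 0

open IsSuper

module _ {P Q : List ℕ → List ℕ → ℤ} (P-super : IsSuper P) (Q-super : IsSuper Q)
         (P≡Q : ∀ v → P v [] ≡ Q v []) where

  private
    -- Strong induction on the first primed exponent, with `n` as a bound: the coefficient at a + 1
    -- depends on those at every j ≤ a. The statement is for all `v`, because the recursion
    -- lengthens `v`.
    step : ∀ u → (∀ v → P v u ≡ Q v u) →
      ∀ n a → a ≤ n → ∀ v → P v (a ∷ u) ≡ Q v (a ∷ u)
    step u eq n zero _ v = trans (drop-y P-super v u) (trans (eq v) (sym (drop-y Q-super v u)))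
    step u eq (suc n) (suc a) (s≤s a≤n) v =
      -- Inserting x_{k+1} with exponent 0 turns the coefficient into the term i = 0 of `cancel`;
      -- all other terms agree for P and Q by `tail-eq`.
      trans (sym (drop-x P-super v (suc a ∷ u))) (trans eq₀ (drop-x Q-super v (suc a ∷ u)))
      where
      term : (List ℕ → List ℕ → ℤ) → ℕ → ℕ → ℤ
      term R i j = sgn i ℤ.* R (v ++ i ∷ []) (j ∷ u)

      tail-eq : C a (λ i j → term P (suc i) j) ≡ C a (λ i j → term Q (suc i) j)
      tail-eq = C-cong a λ i j i+j≡a → cong (sgn (suc i) ℤ.*_)
        (step u eq n j (ℕ.≤-trans (subst (j ≤_) i+j≡a (ℕ.m≤n+m j i)) a≤n) (v ++ suc i ∷ []))

      eq₀ : P (v ++ 0 ∷ []) (suc a ∷ u) ≡ Q (v ++ 0 ∷ []) (suc a ∷ u)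
      eq₀ = trans (sym (ℤ.*-identityˡ _)) (trans (ℤGroup.∙-cancelʳ (C a (λ i j → term P (suc i) j)) _ _
        (trans (trans (sym (C-suc a (term P))) (trans (cancel P-super a v u) (sym (cancel Q-super a v u))))
          (trans (C-suc a (term Q)) (cong (ℤ._+_ (term Q 0 (suc a))) (sym tail-eq))))) (ℤ.*-identityˡ _))

  super-unique : ∀ u v → P v u ≡ Q v u
  super-unique [] v = P≡Q v
  super-unique (a ∷ u) v = step u (super-unique u) a a ℕ.≤-refl v

module _ {f g : List ℕ → List ℕ → ℤ} (f-super : IsSuper f) (g-super : IsSuper g) where

  private
    P : List ℕ → List ℕ → ℤ
    P v u = S v (λ v₁ v₂ → S u (λ u₁ u₂ → f v₁ u₁ ℤ.* g v₂ u₂))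

    module _ (v₁ v₂ u₁ u₂ : List ℕ) where

      term-f term-g : ℕ → ℕ → ℤ
      term-f i j = sgn i ℤ.* f (v₁ ++ i ∷ []) (j ∷ u₁)
      term-g i j = sgn i ℤ.* g (v₂ ++ i ∷ []) (j ∷ u₂)

      *-vanish : ∀ m n a → m + n ≡ suc a → C m term-f ℤ.* C n term-g ≡ + 0
      *-vanish (suc m) n a _ = trans (cong (ℤ._* C n term-g) (cancel f-super m v₁ u₁)) (ℤ.*-zeroˡ (C n term-g))
      *-vanish zero (suc n) a _ = trans (cong (C 0 term-f ℤ.*_) (cancel g-super n v₂ u₂)) (ℤ.*-zeroʳ (C 0 term-f))

      pull-sgn : ∀ i j → sgn i ℤ.* C i (λ i₁ i₂ → C j (λ j₁ j₂ →
        f (v₁ ++ i₁ ∷ []) (j₁ ∷ u₁) ℤ.* g (v₂ ++ i₂ ∷ []) (j₂ ∷ u₂))) ≡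
        C i (λ i₁ i₂ → C j (λ j₁ j₂ → term-f i₁ j₁ ℤ.* term-g i₂ j₂))
      pull-sgn i j = trans (sym (C-*ˡ (sgn i) i)) (C-cong i λ i₁ i₂ i₁+i₂≡i →
        trans (sym (C-*ˡ (sgn i) j)) (C-cong j λ j₁ j₂ _ →
          trans (cong (ℤ._* _) (trans (cong sgn (sym i₁+i₂≡i)) (sgn-+ i₁ i₂)))
            (rearrange (sgn i₁) (sgn i₂) (f (v₁ ++ i₁ ∷ []) (j₁ ∷ u₁)) (g (v₂ ++ i₂ ∷ []) (j₂ ∷ u₂)))))
        where
        rearrange : ∀ a b c d → a ℤ.* b ℤ.* (c ℤ.* d) ≡ a ℤ.* c ℤ.* (b ℤ.* d)
        rearrange = ℤSolver.solve-∀

      -- The substitution is multiplicative: after regrouping, the part of degree a + 1 of the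
      -- product is the convolution of the parts of degree m and n of the factors. As m + n is
      -- positive, one of these two parts has positive degree and vanishes.
      cancel-* : ∀ a → C (suc a) (λ i j → sgn i ℤ.* C i (λ i₁ i₂ → C j (λ j₁ j₂ →
        f (v₁ ++ i₁ ∷ []) (j₁ ∷ u₁) ℤ.* g (v₂ ++ i₂ ∷ []) (j₂ ∷ u₂)))) ≡ + 0
      cancel-* a = begin
        _ ≡⟨ C-cong (suc a) (λ i j _ → pull-sgn i j) ⟩
        _ ≡⟨ C-interchange (suc a) (λ i₁ i₂ j₁ j₂ → term-f i₁ j₁ ℤ.* term-g i₂ j₂) ⟩
        _ ≡⟨ C-cong (suc a) (λ m n _ → C-*-C m n term-f term-g) ⟩
        C (suc a) (λ m n → C m term-f ℤ.* C n term-g) ≡⟨ C-cong (suc a) (λ m n → *-vanish m n a) ⟩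
        C (suc a) (λ _ _ → + 0) ≡⟨ C-0 (suc a) ⟩
        + 0 ∎
        where open ≡-Reasoning

  *-super : IsSuper (λ v u → S v (λ v₁ v₂ → S u (λ u₁ u₂ → f v₁ u₁ ℤ.* g v₂ u₂)))
  *-super .drop-x v u = trans (S-snoc v 0 _) (S-cong v λ v₁ v₂ → trans (C-zero _) (S-cong u λ u₁ u₂ →
    cong₂ ℤ._*_ (drop-x f-super v₁ u₁) (drop-x g-super v₂ u₂)))
  *-super .drop-y v u = S-cong v λ v₁ v₂ → trans (trans (S-∷ 0 u _) (C-zero _)) (S-cong u λ u₁ u₂ →
    cong₂ ℤ._*_ (drop-y f-super v₁ u₁) (drop-y g-super v₂ u₂))
  *-super .cancel a v u = begin
    C (suc a) (λ i j → sgn i ℤ.* P (v ++ i ∷ []) (j ∷ u))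
      ≡⟨ C-cong (suc a) (λ i j _ → cong (sgn i ℤ.*_) (split i j)) ⟩
    C (suc a) (λ i j → sgn i ℤ.* S v (λ v₁ v₂ → S u (λ u₁ u₂ → term i j v₁ v₂ u₁ u₂)))
      ≡⟨ C-cong (suc a) (λ i j _ → sym (trans (∑-cong (splits v) (λ _ _ → ∑-*ˡ (sgn i) (splits u))) (∑-*ˡ (sgn i) (splits v)))) ⟩
    C (suc a) (λ i j → S v (λ v₁ v₂ → S u (λ u₁ u₂ → sgn i ℤ.* term i j v₁ v₂ u₁ u₂)))
      ≡⟨ trans (C-S (suc a) v) (S-cong v λ _ _ → C-S (suc a) u) ⟩
    S v (λ v₁ v₂ → S u (λ u₁ u₂ → C (suc a) (λ i j → sgn i ℤ.* term i j v₁ v₂ u₁ u₂)))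
      ≡⟨ S-cong v (λ v₁ v₂ → S-cong u (λ u₁ u₂ → cancel-* v₁ v₂ u₁ u₂ a)) ⟩
    S v (λ _ _ → S u (λ _ _ → + 0))
      ≡⟨ trans (S-cong v (λ _ _ → ∑-0 (splits u))) (∑-0 (splits v)) ⟩
    + 0 ∎
    where
    open ≡-Reasoning
    term : ℕ → ℕ → (v₁ v₂ u₁ u₂ : List ℕ) → ℤ
    term i j v₁ v₂ u₁ u₂ = C i (λ i₁ i₂ → C j (λ j₁ j₂ →
      f (v₁ ++ i₁ ∷ []) (j₁ ∷ u₁) ℤ.* g (v₂ ++ i₂ ∷ []) (j₂ ∷ u₂)))

    split : ∀ i j → P (v ++ i ∷ []) (j ∷ u) ≡ S v (λ v₁ v₂ → S u (λ u₁ u₂ → term i j v₁ v₂ u₁ u₂))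
    split i j = trans (S-snoc v i _) (S-cong v λ v₁ v₂ →
      trans (C-cong i λ i₁ i₂ _ → trans (S-∷ j u _) (C-S j u)) (C-S i u))

sum-snoc : ∀ v i → sum (v ++ i ∷ []) ≡ sum v + i
sum-snoc v i = trans (sum-++ v (i ∷ [])) (cong (_+_ (sum v)) (ℕ.+-identityʳ i))

-- The index set depends on the total degree only, and all terms of one instance of `cancel` have
-- the same degree, so the sum over it can be moved outside.
∑-super : (B : ℕ → List X) (c : X → ℤ) (P : X → List ℕ → List ℕ → ℤ) →
  (∀ d x → x ∈ B d → IsSuper (P x)) → IsSuper (λ v u → ∑ (B (sum v + sum u)) (λ x → c x ℤ.* P x v u))
∑-super B c P P-super .drop-x v u = trans
  (cong (λ s → ∑ (B (s + sum u)) (λ x → c x ℤ.* P x (v ++ 0 ∷ []) u)) (trans (sum-snoc v 0) (ℕ.+-identityʳ (sum v))))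
  (∑-cong (B (sum v + sum u)) λ x x∈ → cong (c x ℤ.*_) (drop-x (P-super _ x x∈) v u))
∑-super B c P P-super .drop-y v u =
  ∑-cong (B (sum v + sum u)) λ x x∈ → cong (c x ℤ.*_) (drop-y (P-super _ x x∈) v u)
∑-super B c P P-super .cancel a v u = begin
  C (suc a) (λ i j → sgn i ℤ.* ∑ (B (sum (v ++ i ∷ []) + (j + sum u))) (λ x → c x ℤ.* P x (v ++ i ∷ []) (j ∷ u)))
    ≡⟨ C-cong (suc a) (λ i j i+j≡ → trans
         (cong (λ d → sgn i ℤ.* ∑ (B d) (λ x → c x ℤ.* P x (v ++ i ∷ []) (j ∷ u))) (degree i j i+j≡))
         (trans (sym (∑-*ˡ (sgn i) Bs))
           (∑-cong Bs λ x _ → rearrange (sgn i) (c x) (P x (v ++ i ∷ []) (j ∷ u))))) ⟩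
  C (suc a) (λ i j → ∑ Bs (λ x → c x ℤ.* (sgn i ℤ.* P x (v ++ i ∷ []) (j ∷ u))))
    ≡⟨ C-∑ (suc a) Bs ⟩
  ∑ Bs (λ x → C (suc a) (λ i j → c x ℤ.* (sgn i ℤ.* P x (v ++ i ∷ []) (j ∷ u))))
    ≡⟨ ∑-cong Bs (λ x x∈ → trans (C-*ˡ (c x) (suc a))
         (trans (cong (c x ℤ.*_) (cancel (P-super _ x x∈) a v u)) (ℤ.*-zeroʳ (c x)))) ⟩
  ∑ Bs (λ _ → + 0)
    ≡⟨ ∑-0 Bs ⟩
  + 0 ∎
  where
  open ≡-Reasoning
  Bs = B (sum v + (suc a + sum u))

  rearrange : ∀ s c p → s ℤ.* (c ℤ.* p) ≡ c ℤ.* (s ℤ.* p)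
  rearrange = ℤSolver.solve-∀

  degree : ∀ i j → i + j ≡ suc a → sum (v ++ i ∷ []) + (j + sum u) ≡ sum v + (suc a + sum u)
  degree i j i+j≡ = trans (cong (_+ (j + sum u)) (sum-snoc v i))
    (trans (ℕ.+-assoc (sum v) i _) (cong (_+_ (sum v)) (trans (sym (ℕ.+-assoc i j (sum u))) (cong (_+ sum u) i+j≡))))

super-cong : ∀ {P Q} → (∀ v u → P v u ≡ Q v u) → IsSuper Q → IsSuper P
super-cong P≡Q Q-super .drop-x v u =
  trans (P≡Q (v ++ 0 ∷ []) u) (trans (drop-x Q-super v u) (sym (P≡Q v u)))
super-cong P≡Q Q-super .drop-y v u =
  trans (P≡Q v (0 ∷ u)) (trans (drop-y Q-super v u) (sym (P≡Q v u)))
super-cong P≡Q Q-super .cancel a v u =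
  trans (C-cong (suc a) λ i j _ → cong (sgn i ℤ.*_) (P≡Q (v ++ i ∷ []) (j ∷ u))) (cancel Q-super a v u)

-- Enumerations of fillings

unique-remove : (xs : List X) {ys : List X} {x : X} →
  Unique (xs ++ x ∷ ys) → Unique (xs ++ ys) × All (x ≢_) (xs ++ ys)
unique-remove [] (x∉ys ∷ ys!) = ys! , x∉ys
unique-remove (z ∷ xs) {ys} {x} (z∉ ∷ xs!) with unique-remove xs xs! | All.++⁻ xs z∉
... | xs++ys! , x∉ | z∉xs , z≢x ∷ z∉ys = All.++⁺ z∉xs z∉ys ∷ xs++ys! , (z≢x ∘ sym) ∷ x∉

∈-remove : (xs : List X) {ys : List X} {x y : X} → y ∈ xs ++ x ∷ ys → x ≢ y → y ∈ xs ++ ys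
∈-remove xs y∈ x≢y with Mem.∈-++⁻ xs y∈
... | inj₁ y∈xs = Mem.∈-++⁺ˡ y∈xs
... | inj₂ (here y≡x) = ⊥-elim (x≢y (sym y≡x))
... | inj₂ (there y∈ys) = Mem.∈-++⁺ʳ xs y∈ys

∈-weaken : (xs : List X) {ys : List X} {x y : X} → y ∈ xs ++ ys → y ∈ xs ++ x ∷ ys
∈-weaken xs y∈ with Mem.∈-++⁻ xs y∈
... | inj₁ y∈xs = Mem.∈-++⁺ˡ y∈xs
... | inj₂ y∈ys = Mem.∈-++⁺ʳ xs (there y∈ys)

∑-remove : (xs : List X) {ys : List X} {x : X} (w : X → ℤ) →
  ∑ (xs ++ x ∷ ys) w ≡ w x ℤ.+ ∑ (xs ++ ys) w
∑-remove xs {ys} {x} w = begin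
  ∑ (xs ++ x ∷ ys) w               ≡⟨ trans (∑-++ xs (x ∷ ys)) (cong (ℤ._+_ (∑ xs w)) (∑-∷ x ys w)) ⟩
  ∑ xs w ℤ.+ (w x ℤ.+ ∑ ys w)      ≡⟨ rearrange (∑ xs w) (w x) (∑ ys w) ⟩
  w x ℤ.+ (∑ xs w ℤ.+ ∑ ys w)      ≡⟨ cong (ℤ._+_ (w x)) (∑-++ xs ys) ⟨
  w x ℤ.+ ∑ (xs ++ ys) w           ∎
  where
  open ≡-Reasoning
  rearrange : ∀ a b c → a ℤ.+ (b ℤ.+ c) ≡ b ℤ.+ (a ℤ.+ c)
  rearrange = ℤSolver.solve-∀

-- Each y removes its image from `xs`; by uniqueness and injectivity the later images survive the
-- removal. What remains when `ys` is exhausted is not an image, so its weight is 0.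
∑-reindex : {φ : Y → X} → (∀ {a b} → φ a ≡ φ b → a ≡ b) →
  (ys : List Y) {xs : List X} → Unique xs → Unique ys → (∀ {y} → y ∈ ys → φ y ∈ xs) →
  (w : X → ℤ) → (∀ {x} → x ∈ xs → w x ≡ + 0 ⊎ ∃ λ y → y ∈ ys × φ y ≡ x) →
  ∑ xs w ≡ ∑ ys (w ∘ φ)
∑-reindex φ-inj [] {xs} xs! _ into w onto =
  trans (∑-cong xs λ x x∈ → outside (onto x∈)) (trans (∑-0 xs) (sym (∑-[] _)))
  where
  outside : ∀ {x} → w x ≡ + 0 ⊎ (∃ λ y → y ∈ [] × _ ≡ x) → w x ≡ + 0
  outside (inj₁ wx≡0) = wx≡0
∑-reindex {φ = φ} φ-inj (y ∷ ys) xs! (y∉ys ∷ ys!) into w onto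
  with Mem.∈-∃++ (into (here refl))
... | as , bs , refl with unique-remove as xs!
... | as++bs! , φy∉ =
  trans (∑-remove as w) (trans (cong (ℤ._+_ (w (φ y)))
    (∑-reindex φ-inj ys as++bs! ys!
      (λ y′∈ → ∈-remove as (into (there y′∈)) (All.lookup y∉ys y′∈ ∘ φ-inj)) w onto′))
    (sym (∑-∷ y ys (w ∘ φ))))
  where
  onto′ : ∀ {x} → x ∈ as ++ bs → w x ≡ + 0 ⊎ ∃ λ y′ → y′ ∈ ys × φ y′ ≡ x
  onto′ x∈ with onto (∈-weaken as x∈)
  ... | inj₁ wx≡0 = inj₁ wx≡0
  ... | inj₂ (y′ , there y′∈ , φy′≡x) = inj₂ (y′ , y′∈ , φy′≡x)
  ... | inj₂ (_ , here refl , φy≡x) = ⊥-elim (All.lookup φy∉ x∈ φy≡x)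

-- Reindexing by τ shows that the sum equals its own negative. Fixed points are allowed: there
-- `flip` itself forces the weight to be 0.
∑-sign-reversing : {τ : X → X} → (∀ x → τ (τ x) ≡ x) →
  {xs : List X} → Unique xs → (∀ {x} → x ∈ xs → τ x ∈ xs) →
  (w : X → ℤ) → (∀ x → x ∈ xs → w (τ x) ≡ - w x) → ∑ xs w ≡ + 0
∑-sign-reversing {τ = τ} invol {xs} xs! closed w flip = ≡-neg⇒≡0 (∑ xs w) (begin
  ∑ xs w            ≡⟨ ∑-reindex (λ {a} {b} τa≡τb → trans (sym (invol a)) (trans (cong τ τa≡τb) (invol b)))
                         xs xs! xs! closed w (λ {x} x∈ → inj₂ (τ x , closed x∈ , invol x)) ⟩
  ∑ xs (w ∘ τ)      ≡⟨ ∑-cong xs flip ⟩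
  ∑ xs (λ x → - w x) ≡⟨ ∑-neg xs ⟩
  - ∑ xs w          ∎)
  where open ≡-Reasoning

concatMap≡cartesianProductWith : (f : X → Y → Z) (xs : List X) (ys : List Y) →
  concatMap (λ x → map (f x) ys) xs ≡ cartesianProductWith f xs ys
concatMap≡cartesianProductWith f [] ys = refl
concatMap≡cartesianProductWith f (x ∷ xs) ys =
  cong (map (f x) ys ++_) (concatMap≡cartesianProductWith f xs ys)

words-unique : {L : List X} → Unique L → ∀ p → Unique (words L p)
words-unique L! zero = [] ∷ []
words-unique {L = L} L! (suc p) =
  subst Unique (sym (concatMap≡cartesianProductWith _∷_ L (words L p)))
    (Unique.cartesianProductWith⁺ _∷_ List.∷-injective L! (words-unique L! p))

fillings-unique : {L : List X} → Unique L → ∀ β → Unique (fillings L β)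
fillings-unique L! [] = [] ∷ []
fillings-unique {L = L} L! (p ∷ β) =
  subst Unique (sym (concatMap≡cartesianProductWith _∷_ (words L p) (fillings L β)))
    (Unique.cartesianProductWith⁺ _∷_ List.∷-injective (words-unique L! p) (fillings-unique L! β))

∈-words⁺ : {L : List X} {w : List X} → All (_∈ L) w → w ∈ words L (length w)
∈-words⁺ [] = here refl
∈-words⁺ {L = L} {w = x ∷ w} (x∈L ∷ w∈L) =
  subst (_ ∈_) (sym (concatMap≡cartesianProductWith _∷_ L (words L (length w))))
    (Mem.∈-cartesianProductWith⁺ _∷_ x∈L (∈-words⁺ w∈L))

∈-words⁻ : (L : List X) (p : ℕ) {w : List X} → w ∈ words L p → length w ≡ p × All (_∈ L) w
∈-words⁻ L zero (here refl) = refl , []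
∈-words⁻ L (suc p) w∈
  with Mem.∈-cartesianProductWith⁻ _∷_ L (words L p)
         (subst (_ ∈_) (concatMap≡cartesianProductWith _∷_ L (words L p)) w∈)
... | x , w , x∈L , w∈′ , refl with ∈-words⁻ L p w∈′
... | |w|≡p , w∈L = cong suc |w|≡p , x∈L ∷ w∈L

∈-fillings⁺ : {L : List X} {F : List (List X)} → All (All (_∈ L)) F → F ∈ fillings L (map length F)
∈-fillings⁺ [] = here refl
∈-fillings⁺ {L = L} {F = w ∷ F} (w∈L ∷ F∈L) =
  subst (_ ∈_) (sym (concatMap≡cartesianProductWith _∷_ (words L (length w)) (fillings L (map length F))))
    (Mem.∈-cartesianProductWith⁺ _∷_ (∈-words⁺ w∈L) (∈-fillings⁺ F∈L))

∈-fillings⁻ : (L : List X) (β : List ℕ) {F : List (List X)} →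
  F ∈ fillings L β → map length F ≡ β × All (All (_∈ L)) F
∈-fillings⁻ L [] (here refl) = refl , []
∈-fillings⁻ L (p ∷ β) F∈
  with Mem.∈-cartesianProductWith⁻ _∷_ (words L p) (fillings L β)
         (subst (_ ∈_) (concatMap≡cartesianProductWith _∷_ (words L p) (fillings L β)) F∈)
... | w , F , w∈ , F∈′ , refl with ∈-words⁻ L p w∈ | ∈-fillings⁻ L β F∈′
... | |w|≡p , w∈L | shape , F∈L = cong₂ _∷_ |w|≡p shape , w∈L ∷ F∈L

unmap : {P : Y → Set} {φ : Y → X} {xs : List X} →
  All (λ x → ∃ λ y → P y × φ y ≡ x) xs → ∃ λ ys → All P ys × map φ ys ≡ xs
unmap [] = [] , [] , refl
unmap ((y , py , refl) ∷ rest) with unmap rest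
... | ys , pys , refl = y ∷ ys , py ∷ pys , refl

-- Serves every change of alphabet below: a filling of nonzero weight uses only letters in the image
-- of φ, so it comes from a unique filling over the smaller alphabet.
∑-relabel : {φ : Y → X} → (∀ {a b} → φ a ≡ φ b → a ≡ b) →
  {L : List X} {L′ : List Y} → Unique L → Unique L′ → (∀ {e} → e ∈ L′ → φ e ∈ L) →
  (β : List ℕ) (w : List (List X) → ℤ) →
  (∀ F → All (All (_∈ L)) F → w F ≡ + 0 ⊎ All (All (λ e → ∃ λ e′ → e′ ∈ L′ × φ e′ ≡ e)) F) →
  ∑ (fillings L β) w ≡ ∑ (fillings L′ β) (w ∘ map (map φ))
∑-relabel {φ = φ} φ-inj {L} {L′} L! L′! into β w onto =
  ∑-reindex (List.map-injective (List.map-injective φ-inj)) (fillings L′ β)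
    (fillings-unique L! β) (fillings-unique L′! β) into′ w onto′
  where
  shape-map : ∀ F → map length (map (map φ) F) ≡ map length F
  shape-map F = trans (sym (List.map-∘ F)) (List.map-cong (List.length-map φ) F)

  into′ : ∀ {F} → F ∈ fillings L′ β → map (map φ) F ∈ fillings L β
  into′ {F} F∈ with ∈-fillings⁻ L′ β F∈
  ... | shape , F∈L′ = subst (λ γ → map (map φ) F ∈ fillings L γ) (trans (shape-map F) shape)
    (∈-fillings⁺ (All.map⁺ (All.map (All.map⁺ ∘ All.map into) F∈L′)))

  onto′ : ∀ {F} → F ∈ fillings L β → w F ≡ + 0 ⊎ ∃ λ G → G ∈ fillings L′ β × map (map φ) G ≡ F
  onto′ {F} F∈ with ∈-fillings⁻ L β F∈
  ... | shape , F∈L with onto F F∈L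
  ... | inj₁ wF≡0 = inj₁ wF≡0
  ... | inj₂ preimages with unmap (All.map unmap preimages)
  ... | G , G∈L′ , refl = inj₂ (G , subst (λ γ → G ∈ fillings L′ γ) (trans (sym (shape-map G)) shape)
    (∈-fillings⁺ G∈L′) , refl)

un-injective : ∀ {a b} → un a ≡ un b → a ≡ b
un-injective refl = refl

pr-injective : ∀ {a b} → pr a ≡ pr b → a ≡ b
pr-injective refl = refl

range1-unique : ∀ n → Unique (range1 n)
range1-unique n = Unique.map⁺ ℕ.suc-injective (Unique.upTo⁺ n)

alphabet-unique : ∀ k l → Unique (alphabet k l)
alphabet-unique k l = Unique.++⁺ (Unique.map⁺ un-injective (range1-unique k))
  (Unique.map⁺ pr-injective (range1-unique l)) disjoint
  where
  disjoint : ∀ {e} → ¬ (e ∈ map un (range1 k) × e ∈ map pr (range1 l))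
  disjoint (e∈un , e∈pr) with Mem.∈-map⁻ un e∈un | Mem.∈-map⁻ pr e∈pr
  ... | _ , _ , refl | _ , _ , ()

data InAlphabet (k l : ℕ) : HL → Set where
  un : ∀ {i} → i < k → InAlphabet k l (un (suc i))
  pr : ∀ {j} → j < l → InAlphabet k l (pr (suc j))

∈-alphabet⁺ : ∀ {k l e} → InAlphabet k l e → e ∈ alphabet k l
∈-alphabet⁺ (un i<k) = Mem.∈-++⁺ˡ (Mem.∈-map⁺ un (Mem.∈-map⁺ suc (Mem.∈-upTo⁺ i<k)))
∈-alphabet⁺ {k} (pr j<l) = Mem.∈-++⁺ʳ (map un (range1 k)) (Mem.∈-map⁺ pr (Mem.∈-map⁺ suc (Mem.∈-upTo⁺ j<l)))

∈-alphabet⁻ : ∀ k l {e} → e ∈ alphabet k l → InAlphabet k l e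
∈-alphabet⁻ k l e∈ with Mem.∈-++⁻ (map un (range1 k)) e∈
... | inj₁ e∈un with Mem.∈-map⁻ un e∈un
... | _ , i∈ , refl with Mem.∈-map⁻ suc i∈
... | _ , i∈′ , refl = un (Mem.∈-upTo⁻ i∈′)
∈-alphabet⁻ k l e∈ | inj₂ e∈pr with Mem.∈-map⁻ pr e∈pr
... | _ , j∈ , refl with Mem.∈-map⁻ suc j∈
... | _ , j∈′ , refl = pr (Mem.∈-upTo⁻ j∈′)

-- Booleans, contents and relabelled tableaux

∧-true⁻ : ∀ a {b} → a ∧ b ≡ true → a ≡ true × b ≡ true
∧-true⁻ true {true} _ = refl , refl

∧-true⁺ : ∀ {a b} → a ≡ true → b ≡ true → a ∧ b ≡ true
∧-true⁺ refl refl = refl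

𝟙-zero-or-true : ∀ b → 𝟙 b ≡ + 0 ⊎ b ≡ true
𝟙-zero-or-true true = inj₂ refl
𝟙-zero-or-true false = inj₁ refl

≡ᵇ-sound : ∀ {m n} → (m ≡ᵇ n) ≡ true → m ≡ n
≡ᵇ-sound {m} {n} eq = ℕ.≡ᵇ⇒≡ m n (subst T (sym eq) tt)

≡ᵇ-refl : ∀ n → (n ≡ᵇ n) ≡ true
≡ᵇ-refl zero = refl
≡ᵇ-refl (suc n) = ≡ᵇ-refl n

≢⇒≡ᵇ-false : ∀ {m n} → m ≢ n → (m ≡ᵇ n) ≡ false
≢⇒≡ᵇ-false {m} {n} m≢n with m ≡ᵇ n in eq
... | true = ⊥-elim (m≢n (≡ᵇ-sound eq))
... | false = refl

≡ᵇ-sym : ∀ m n → (m ≡ᵇ n) ≡ (n ≡ᵇ m)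
≡ᵇ-sym zero zero = refl
≡ᵇ-sym zero (suc n) = refl
≡ᵇ-sym (suc m) zero = refl
≡ᵇ-sym (suc m) (suc n) = ≡ᵇ-sym m n

length-snoc : (xs : List X) (x : X) → length (xs ++ x ∷ []) ≡ suc (length xs)
length-snoc [] x = refl
length-snoc (y ∷ xs) x = cong suc (length-snoc xs x)

range1-snoc : ∀ n → range1 (suc n) ≡ range1 n ++ suc n ∷ []
range1-snoc n = trans (cong (map suc) (sym (List.upTo-∷ʳ n))) (List.map-++ suc (upTo n) (n ∷ []))

range1-suc : ∀ n → range1 (suc n) ≡ 1 ∷ map suc (range1 n)
range1-suc n = cong (1 ∷_) (cong (map suc) (sym (List.map-upTo suc n)))

eqListᵇ-snoc : ∀ xs ys {x y} → length xs ≡ length ys →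
  eqListᵇ (xs ++ x ∷ []) (ys ++ y ∷ []) ≡ eqListᵇ xs ys ∧ (x ≡ᵇ y)
eqListᵇ-snoc [] [] _ = ∧-identityʳ _
eqListᵇ-snoc (x ∷ xs) (y ∷ ys) |xs|≡|ys| =
  trans (cong ((x ≡ᵇ y) ∧_) (eqListᵇ-snoc xs ys (ℕ.suc-injective |xs|≡|ys|))) (sym (∧-assoc (x ≡ᵇ y) _ _))

matches : (ℕ → ℕ) → List ℕ → Bool
matches f v = eqListᵇ (map f (range1 (length v))) v

matches-snoc : ∀ f v i → matches f (v ++ i ∷ []) ≡ matches f v ∧ (f (suc (length v)) ≡ᵇ i)
matches-snoc f v i =
  trans (cong (λ is → eqListᵇ (map f is) (v ++ i ∷ [])) (trans (cong range1 (length-snoc v i)) (range1-snoc (length v))))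
    (trans (cong (λ ns → eqListᵇ ns (v ++ i ∷ [])) (List.map-++ f (range1 (length v)) _))
      (eqListᵇ-snoc (map f (range1 (length v))) v
        (trans (List.length-map f (range1 (length v))) (trans (List.length-map suc (upTo (length v))) (List.length-upTo (length v))))))

matches-∷ : ∀ f j u → matches f (j ∷ u) ≡ (f 1 ≡ᵇ j) ∧ matches (f ∘ suc) u
matches-∷ f j u =
  trans (cong (λ is → eqListᵇ (map f is) (j ∷ u)) (range1-suc (length u)))
    (cong (λ ns → (f 1 ≡ᵇ j) ∧ eqListᵇ ns u) (sym (List.map-∘ (range1 (length u)))))

matches-cong : ∀ {f g} v → (∀ i → i < length v → f (suc i) ≡ g (suc i)) → matches f v ≡ matches g v
matches-cong v eq = cong (λ ns → eqListᵇ ns v)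
  (List.map-cong-local (All.map⁺ (All.map (λ {i} → eq i) (All.all-upTo (length v)))))

count-cong : {p q : X → Bool} (F : List (List X)) → (∀ e → p e ≡ q e) → count p F ≡ count q F
count-cong {p = p} {q} F eq = cong sum (List.map-cong (λ w → row w) F)
  where
  row : ∀ w → length (filterᵇ p w) ≡ length (filterᵇ q w)
  row [] = refl
  row (e ∷ w) rewrite eq e with q e
  ... | true = cong suc (row w)
  ... | false = row w

count-map : (p : Y → Bool) (φ : X → Y) (F : List (List X)) → count p (map (map φ) F) ≡ count (p ∘ φ) F
count-map p φ F = cong sum (trans (sym (List.map-∘ F)) (List.map-cong row F))
  where
  row : ∀ w → length (filterᵇ p (map φ w)) ≡ length (filterᵇ (p ∘ φ) w)
  row [] = refl
  row (e ∷ w) with p (φ e)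
  ... | true = cong suc (row w)
  ... | false = row w

count-none : (p : X → Bool) {F : List (List X)} → All (All (λ e → p e ≡ false)) F → count p F ≡ 0
count-none p [] = refl
count-none p (w ∷ F) = cong₂ _+_ (row w) (count-none p F)
  where
  row : ∀ {w} → All (λ e → p e ≡ false) w → length (filterᵇ p w) ≡ 0
  row [] = refl
  row (e ∷ w) rewrite e = row w

count≡0⇒none : (p : X → Bool) (F : List (List X)) → count p F ≡ 0 → All (All (λ e → p e ≡ false)) F
count≡0⇒none p [] _ = []
count≡0⇒none p (w ∷ F) eq =
  row w (ℕ.m+n≡0⇒m≡0 _ eq) ∷ count≡0⇒none p F (ℕ.m+n≡0⇒n≡0 (length (filterᵇ p w)) eq)
  where
  row : ∀ w → length (filterᵇ p w) ≡ 0 → All (λ e → p e ≡ false) w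
  row [] _ = []
  row (e ∷ w) eq with p e in pe
  ... | false = pe ∷ row w eq

all-cong : {p q : X → Bool} (xs : List X) → (∀ x → p x ≡ q x) → all p xs ≡ all q xs
all-cong [] eq = refl
all-cong (x ∷ xs) eq = cong₂ _∧_ (eq x) (all-cong xs eq)

all-map : (p : Y → Bool) (f : X → Y) (xs : List X) → all p (map f xs) ≡ all (p ∘ f) xs
all-map p f [] = refl
all-map p f (x ∷ xs) = cong (p (f x) ∧_) (all-map p f xs)

related : (X → X → Bool) → List X → Bool
related r w = all (λ { (a , b) → r a b }) (adjPairs w)

relatedPointwise : (X → X → Bool) → List X → List X → Bool
relatedPointwise c lo up = all (λ { (a , b) → c a b }) (zip lo up)

-- The common form of `isSSYCT` and `isHCT`, so that relabelling is treated once for both;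
-- `isTableau` does the same for `isSSYT` and `isSSHT`.
isCompositionTableau : (r c : X → X → Bool) (t : Maybe X → Maybe X → Maybe X → Bool) → List (List X) → Bool
isCompositionTableau r c t F = all (related r) F ∧ related c (heads F) ∧ tripleOK t F

isTableau : (r c : X → X → Bool) → List (List X) → Bool
isTableau r c F = all (related r) F ∧ related (relatedPointwise c) F

related-map : {r : Y → Y → Bool} {r′ : X → X → Bool} {φ : X → Y} → (∀ a b → r (φ a) (φ b) ≡ r′ a b) →
  ∀ w → related r (map φ w) ≡ related r′ w
related-map eq [] = refl
related-map eq (a ∷ []) = refl
related-map eq (a ∷ b ∷ w) = cong₂ _∧_ (eq a b) (related-map eq (b ∷ w))

relatedPointwise-map : {c : Y → Y → Bool} {c′ : X → X → Bool} {φ : X → Y} → (∀ a b → c (φ a) (φ b) ≡ c′ a b) →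
  ∀ lo up → relatedPointwise c (map φ lo) (map φ up) ≡ relatedPointwise c′ lo up
relatedPointwise-map eq [] up = refl
relatedPointwise-map eq (a ∷ lo) [] = refl
relatedPointwise-map eq (a ∷ lo) (b ∷ up) = cong₂ _∧_ (eq a b) (relatedPointwise-map eq lo up)

heads-map : (φ : X → Y) (F : List (List X)) → heads (map (map φ) F) ≡ map φ (heads F)
heads-map φ [] = refl
heads-map φ ([] ∷ F) = heads-map φ F
heads-map φ ((x ∷ w) ∷ F) = cong (φ x ∷_) (heads-map φ F)

nth-map : (φ : X → Y) (xs : List X) (i : ℕ) → nth (map φ xs) i ≡ Maybe.map φ (nth xs i)
nth-map φ [] i = refl
nth-map φ (x ∷ xs) zero = refl
nth-map φ (x ∷ xs) (suc i) = nth-map φ xs i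

hat-∷ : (w : List X) (F : List (List X)) (i c : ℕ) → hat (w ∷ F) (suc i) c ≡ hat F i c
hat-∷ w F i c with nth F i
... | nothing = refl
... | just row = refl

hat-map : (φ : X → Y) (F : List (List X)) (i c : ℕ) → hat (map (map φ) F) i c ≡ Maybe.map φ (hat F i c)
hat-map φ [] i c = refl
hat-map φ (w ∷ F) zero c = nth-map φ w c
hat-map φ (w ∷ F) (suc i) c =
  trans (hat-∷ (map φ w) (map (map φ) F) i c)
    (trans (hat-map φ F i c) (cong (Maybe.map φ) (sym (hat-∷ w F i c))))

tripleOK-map : {t : Maybe Y → Maybe Y → Maybe Y → Bool} {t′ : Maybe X → Maybe X → Maybe X → Bool} {φ : X → Y} →
  (∀ a b c → t (Maybe.map φ a) (Maybe.map φ b) (Maybe.map φ c) ≡ t′ a b c) →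
  ∀ F → tripleOK t (map (map φ) F) ≡ tripleOK t′ F
tripleOK-map {t = t} {t′} {φ} eq F
  rewrite List.length-map (map φ) F
        | trans (sym (List.map-∘ {g = length} {f = map φ} F)) (List.map-cong (List.length-map φ) F)
  = all-cong (upTo (length F)) λ i → all-cong (rangeFrom (suc i) (length F)) λ j →
    all-cong (upTo (maxLen F ∸ 1)) λ c → trans
      (cong₂ (λ A (B , C) → t A B C) (hat-map φ F i (suc c)) (cong₂ _,_ (hat-map φ F j c) (hat-map φ F j (suc c))))
      (eq (hat F i (suc c)) (hat F j c) (hat F j (suc c)))

isCompositionTableau-map : {r c : Y → Y → Bool} {r′ c′ : X → X → Bool}
  {t : Maybe Y → Maybe Y → Maybe Y → Bool} {t′ : Maybe X → Maybe X → Maybe X → Bool} {φ : X → Y} →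
  (∀ a b → r (φ a) (φ b) ≡ r′ a b) → (∀ a b → c (φ a) (φ b) ≡ c′ a b) →
  (∀ a b c → t (Maybe.map φ a) (Maybe.map φ b) (Maybe.map φ c) ≡ t′ a b c) →
  ∀ F → isCompositionTableau r c t (map (map φ) F) ≡ isCompositionTableau r′ c′ t′ F
isCompositionTableau-map {r = r} {c} {t = t} {φ = φ} r-eq c-eq t-eq F =
  cong₂ _∧_ (trans (all-map (related r) (map φ) F) (all-cong F (related-map r-eq)))
    (cong₂ _∧_ (trans (cong (related c) (heads-map φ F)) (related-map c-eq (heads F))) (tripleOK-map {t = t} t-eq F))

isTableau-map : {r c : Y → Y → Bool} {r′ c′ : X → X → Bool} {φ : X → Y} →
  (∀ a b → r (φ a) (φ b) ≡ r′ a b) → (∀ a b → c (φ a) (φ b) ≡ c′ a b) →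
  ∀ F → isTableau r c (map (map φ) F) ≡ isTableau r′ c′ F
isTableau-map {r = r} {φ = φ} r-eq c-eq F =
  cong₂ _∧_ (trans (all-map (related r) (map φ) F) (all-cong F (related-map r-eq)))
    (related-map (relatedPointwise-map c-eq) F)

-- Restriction of the alphabet

countUn countPr : List (List HL) → ℕ → ℕ
countUn F i = count (λ e → un i =L e) F
countPr F j = count (λ e → pr j =L e) F

-- Embeds the alphabet into the one with an additional smallest primed letter. All tableau
-- conditions are comparisons of letters, and these are kept.
shiftPr : HL → HL
shiftPr (un a) = un a
shiftPr (pr b) = pr (suc b)

shiftPr-injective : ∀ {a b} → shiftPr a ≡ shiftPr b → a ≡ b
shiftPr-injective {un a} {un a} refl = refl
shiftPr-injective {pr b} {pr b} refl = refl

suc-≤ᵇ : ∀ m n → (suc m ≤ᵇ suc n) ≡ (m ≤ᵇ n)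
suc-≤ᵇ zero n = refl
suc-≤ᵇ (suc m) n = refl

≤L-shiftPr : ∀ a b → (shiftPr a ≤L shiftPr b) ≡ (a ≤L b)
≤L-shiftPr (un a) (un b) = refl
≤L-shiftPr (un a) (pr b) = refl
≤L-shiftPr (pr a) (un b) = refl
≤L-shiftPr (pr a) (pr b) = suc-≤ᵇ a b

<L-shiftPr : ∀ a b → (shiftPr a <L shiftPr b) ≡ (a <L b)
<L-shiftPr (un a) (un b) = refl
<L-shiftPr (un a) (pr b) = refl
<L-shiftPr (pr a) (un b) = refl
<L-shiftPr (pr a) (pr b) = refl

≥L∞-shiftPr : ∀ a b → (shiftPr a ≥L∞ Maybe.map shiftPr b) ≡ (a ≥L∞ b)
≥L∞-shiftPr a nothing = refl
≥L∞-shiftPr a (just b) = ≤L-shiftPr b a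

>L∞-shiftPr : ∀ a b → (shiftPr a >L∞ Maybe.map shiftPr b) ≡ (a >L∞ b)
>L∞-shiftPr a nothing = refl
>L∞-shiftPr a (just b) = <L-shiftPr b a

rowPair-shiftPr : ∀ a b → rowPair (shiftPr a) (shiftPr b) ≡ rowPair a b
rowPair-shiftPr (un a) (un b) = refl
rowPair-shiftPr (un a) (pr b) = refl
rowPair-shiftPr (pr a) (un b) = refl
rowPair-shiftPr (pr a) (pr b) = refl

colPair-shiftPr : ∀ a b → colPair (shiftPr a) (shiftPr b) ≡ colPair a b
colPair-shiftPr (un a) (un b) = refl
colPair-shiftPr (un a) (pr b) = refl
colPair-shiftPr (pr a) (un b) = refl
colPair-shiftPr (pr a) (pr b) = refl

hctTriple-shiftPr : ∀ a b c →
  hctTriple (Maybe.map shiftPr a) (Maybe.map shiftPr b) (Maybe.map shiftPr c) ≡ hctTriple a b c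
hctTriple-shiftPr nothing b c = refl
hctTriple-shiftPr (just (un a)) b c =
  cong₂ (λ p q → if p then q else true) (≥L∞-shiftPr (un a) b) (>L∞-shiftPr (un a) c)
hctTriple-shiftPr (just (pr a)) b c =
  cong₂ (λ p q → if p then q else true) (>L∞-shiftPr (pr a) b) (≥L∞-shiftPr (pr a) c)

rowPair-un : ∀ a b → rowPair (un a) (un b) ≡ (a ≤ᵇ b)
rowPair-un zero zero = refl
rowPair-un zero (suc b) = refl
rowPair-un (suc a) zero = refl
rowPair-un (suc a) (suc b) = trans (rowPair-un a b) (sym (suc-≤ᵇ a b))

∨-false : ∀ a b → a ∨ (b ∧ false) ≡ a
∨-false true b = refl
∨-false false true = refl
∨-false false false = refl

hctTriple-un : ∀ a b c → hctTriple (Maybe.map un a) (Maybe.map un b) (Maybe.map un c) ≡ ssyctTriple a b c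
hctTriple-un nothing b c = refl
hctTriple-un (just a) nothing c = refl
hctTriple-un (just a) (just b) nothing = refl
hctTriple-un (just a) (just b) (just c) = refl

letters : ∀ k l {F : List (List HL)} → All (All (_∈ alphabet k l)) F → All (All (InAlphabet k l)) F
letters k l = All.map (All.map (∈-alphabet⁻ k l))

module _ (valid : List (List HL) → Bool) where

  hookWeight : List ℕ → List ℕ → List (List HL) → ℤ
  hookWeight v u F = 𝟙 (valid F ∧ hookContentOK v u F)

  hookCoeff : List ℕ → List ℕ → List ℕ → ℤ
  hookCoeff β v u = ∑ (fillings (alphabet (length v) (length u)) β) (hookWeight v u)

  -- A filling of nonzero weight contains the letter k+1 zero times, hence is a filling over the
  -- smaller alphabet; the relabelling is the identity.
  hookCoeff-drop-x : ∀ β v u → hookCoeff β (v ++ 0 ∷ []) u ≡ hookCoeff β v u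
  hookCoeff-drop-x β v u = begin
    hookCoeff β (v ++ 0 ∷ []) u
      ≡⟨ cong (λ k → ∑ (fillings (alphabet k (length u)) β) (hookWeight (v ++ 0 ∷ []) u)) (length-snoc v 0) ⟩
    ∑ (fillings (alphabet (suc k) l) β) (hookWeight (v ++ 0 ∷ []) u)
      ≡⟨ ∑-relabel id (alphabet-unique (suc k) l) (alphabet-unique k l) into β _ onto ⟩
    ∑ (fillings (alphabet k l) β) (hookWeight (v ++ 0 ∷ []) u ∘ map (map id))
      ≡⟨ ∑-cong (fillings (alphabet k l) β) (λ F F∈ → cong 𝟙 (restrict F F∈)) ⟩
    hookCoeff β v u ∎
    where
    open ≡-Reasoning
    k l : ℕ
    k = length v
    l = length u

    into : ∀ {e} → e ∈ alphabet k l → e ∈ alphabet (suc k) l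
    into e∈ with ∈-alphabet⁻ k l e∈
    ... | un i<k = ∈-alphabet⁺ (un (ℕ.m≤n⇒m≤1+n i<k))
    ... | pr j<l = ∈-alphabet⁺ (pr j<l)

    content : ∀ F → hookContentOK (v ++ 0 ∷ []) u F ≡
      (matches (countUn F) v ∧ (countUn F (suc k) ≡ᵇ 0)) ∧ matches (countPr F) u
    content F = cong (_∧ matches (countPr F) u) (matches-snoc (countUn F) v 0)

    avoid : ∀ {e} → InAlphabet (suc k) l e → (un (suc k) =L e) ≡ false →
      ∃ λ e′ → e′ ∈ alphabet k l × e′ ≡ e
    avoid (un {i} i≤k) x≢e = un (suc i) , ∈-alphabet⁺ (un (ℕ.≤∧≢⇒< (ℕ.≤-pred i≤k) i≢k)) , refl
      where
      i≢k : i ≢ k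
      i≢k refl with trans (sym (≡ᵇ-refl k)) x≢e
      ... | ()
    avoid (pr j<l) _ = _ , ∈-alphabet⁺ (pr j<l) , refl

    onto : ∀ F → All (All (_∈ alphabet (suc k) l)) F →
      hookWeight (v ++ 0 ∷ []) u F ≡ + 0 ⊎ All (All (λ e → ∃ λ e′ → e′ ∈ alphabet k l × e′ ≡ e)) F
    onto F F∈ with 𝟙-zero-or-true (valid F ∧ hookContentOK (v ++ 0 ∷ []) u F)
    ... | inj₁ w≡0 = inj₁ w≡0
    ... | inj₂ ok = inj₂ (All.zipWith (All.zipWith λ (e∈ , x≢e) → avoid e∈ x≢e)
      (letters (suc k) l F∈ , count≡0⇒none _ F (≡ᵇ-sound
        (proj₂ (∧-true⁻ (matches (countUn F) v) (proj₁ (∧-true⁻ (matches (countUn F) v ∧ (countUn F (suc k) ≡ᵇ 0))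
          (trans (sym (content F)) (proj₂ (∧-true⁻ (valid F) ok))))))))))

    absent : ∀ {e} → InAlphabet k l e → (un (suc k) =L e) ≡ false
    absent (un i<k) = ≢⇒≡ᵇ-false (ℕ.>⇒≢ i<k)
    absent (pr _) = refl

    restrict : ∀ F → F ∈ fillings (alphabet k l) β →
      valid (map (map id) F) ∧ hookContentOK (v ++ 0 ∷ []) u (map (map id) F) ≡ valid F ∧ hookContentOK v u F
    restrict F F∈ = trans
      (cong (λ G → valid G ∧ hookContentOK (v ++ 0 ∷ []) u G) (trans (List.map-cong List.map-id F) (List.map-id F)))
      (cong (valid F ∧_) (trans (content F) (cong (_∧ matches (countPr F) u) (trans
        (cong (λ n → matches (countUn F) v ∧ (n ≡ᵇ 0))
          (count-none _ (All.map (All.map absent) (letters k l (proj₂ (∈-fillings⁻ _ β F∈))))))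
        (∧-identityʳ _)))))

  hookCoeff-drop-y : (∀ F → valid (map (map shiftPr) F) ≡ valid F) →
    ∀ β v u → hookCoeff β v (0 ∷ u) ≡ hookCoeff β v u
  hookCoeff-drop-y valid-shiftPr β v u = begin
    hookCoeff β v (0 ∷ u)
      ≡⟨ ∑-relabel shiftPr-injective (alphabet-unique k (suc l)) (alphabet-unique k l) into β _ onto ⟩
    ∑ (fillings (alphabet k l) β) (hookWeight v (0 ∷ u) ∘ map (map shiftPr))
      ≡⟨ ∑-cong (fillings (alphabet k l) β) (λ F F∈ → cong 𝟙 (cong₂ _∧_ (valid-shiftPr F) (restrict F F∈))) ⟩
    hookCoeff β v u ∎
    where
    open ≡-Reasoning
    k l : ℕ
    k = length v
    l = length u

    into : ∀ {e} → e ∈ alphabet k l → shiftPr e ∈ alphabet k (suc l)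
    into e∈ with ∈-alphabet⁻ k l e∈
    ... | un i<k = ∈-alphabet⁺ (un i<k)
    ... | pr j<l = ∈-alphabet⁺ (pr (s≤s j<l))

    content : ∀ F → hookContentOK v (0 ∷ u) F ≡
      matches (countUn F) v ∧ ((countPr F 1 ≡ᵇ 0) ∧ matches (countPr F ∘ suc) u)
    content F = cong (matches (countUn F) v ∧_) (matches-∷ (countPr F) 0 u)

    avoid : ∀ {e} → InAlphabet k (suc l) e → (pr 1 =L e) ≡ false →
      ∃ λ e′ → e′ ∈ alphabet k l × shiftPr e′ ≡ e
    avoid (un i<k) _ = _ , ∈-alphabet⁺ (un i<k) , refl
    avoid (pr {suc j} (s≤s j<l)) _ = pr (suc j) , ∈-alphabet⁺ (pr j<l) , refl

    onto : ∀ F → All (All (_∈ alphabet k (suc l))) F →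
      hookWeight v (0 ∷ u) F ≡ + 0 ⊎ All (All (λ e → ∃ λ e′ → e′ ∈ alphabet k l × shiftPr e′ ≡ e)) F
    onto F F∈ with 𝟙-zero-or-true (valid F ∧ hookContentOK v (0 ∷ u) F)
    ... | inj₁ w≡0 = inj₁ w≡0
    ... | inj₂ ok = inj₂ (All.zipWith (All.zipWith λ (e∈ , y≢e) → avoid e∈ y≢e)
      (letters k (suc l) F∈ , count≡0⇒none _ F (≡ᵇ-sound
        (proj₁ (∧-true⁻ (countPr F 1 ≡ᵇ 0) (proj₂ (∧-true⁻ (matches (countUn F) v)
          (trans (sym (content F)) (proj₂ (∧-true⁻ (valid F) ok))))))))))

    absent : ∀ {e} → InAlphabet k l e → (pr 1 =L shiftPr e) ≡ false
    absent (un _) = refl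
    absent (pr _) = refl

    un-shiftPr : ∀ i e → (un i =L shiftPr e) ≡ (un i =L e)
    un-shiftPr i (un a) = refl
    un-shiftPr i (pr b) = refl

    pr-shiftPr : ∀ i e → (pr (suc i) =L shiftPr e) ≡ (pr i =L e)
    pr-shiftPr i (un a) = refl
    pr-shiftPr i (pr b) = refl

    restrict : ∀ F → F ∈ fillings (alphabet k l) β →
      hookContentOK v (0 ∷ u) (map (map shiftPr) F) ≡ hookContentOK v u F
    restrict F F∈ = trans (content (map (map shiftPr) F)) (cong₂ _∧_
      (matches-cong v λ i _ → trans (count-map _ shiftPr F) (count-cong F (un-shiftPr (suc i))))
      (cong₂ (λ n b → (n ≡ᵇ 0) ∧ b)
        (trans (count-map _ shiftPr F)
          (count-none _ (All.map (All.map absent) (letters k l (proj₂ (∈-fillings⁻ _ β F∈))))))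
        (matches-cong u λ j _ → trans (count-map _ shiftPr F) (count-cong F (pr-shiftPr (suc j))))))

  -- At `u = []` the alphabet has no primed letters, and the primed half of the content condition is
  -- trivially true.
  hookCoeff-unprimed : {valid′ : List (List ℕ) → Bool} → (∀ F → valid (map (map un) F) ≡ valid′ F) →
    ∀ β v → hookCoeff β v [] ≡
      ∑ (fillings (range1 (length v)) β) (λ F → 𝟙 (valid′ F ∧ eqListᵇ (contentℕ (length v) F) v))
  hookCoeff-unprimed valid-un β v = trans
    (∑-relabel un-injective (alphabet-unique k 0) (range1-unique k) (Mem.∈-++⁺ˡ ∘ Mem.∈-map⁺ un) β _
      (λ F F∈ → inj₂ (All.map (All.map (unprimed ∘ ∈-alphabet⁻ k 0)) F∈)))
    (∑-cong (fillings (range1 k) β) λ F _ → cong 𝟙 (cong₂ _∧_ (valid-un F)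
      (trans (∧-identityʳ _) (matches-cong v λ i _ →
        trans (count-map _ un F) (count-cong F (≡ᵇ-sym (suc i)))))))
    where
    k = length v
    unprimed : ∀ {e} → InAlphabet k 0 e → ∃ λ i → i ∈ range1 k × un i ≡ e
    unprimed (un i<k) = _ , Mem.∈-map⁺ suc (Mem.∈-upTo⁺ i<k) , refl

hqCoeff≡ : ∀ β v u → hqCoeff β v u ≡ hookCoeff isHCT β v u
hqCoeff≡ β v u = length-filter _ (fillings (alphabet (length v) (length u)) β)

hsCoeff≡ : ∀ μ v u → hsCoeff μ v u ≡ hookCoeff isSSHT μ v u
hsCoeff≡ μ v u = length-filter _ (fillings (alphabet (length v) (length u)) μ)

isHCT-shiftPr : ∀ F → isHCT (map (map shiftPr) F) ≡ isHCT F
isHCT-shiftPr = isCompositionTableau-map {t = hctTriple} rowPair-shiftPr colPair-shiftPr hctTriple-shiftPr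

isSSHT-shiftPr : ∀ F → isSSHT (map (map shiftPr) F) ≡ isSSHT F
isSSHT-shiftPr = isTableau-map rowPair-shiftPr colPair-shiftPr

isHCT-un : ∀ F → isHCT (map (map un) F) ≡ isSSYCT F
isHCT-un = isCompositionTableau-map {t = hctTriple} rowPair-un (λ a b → ∨-false (a <ᵇ b) (a ≡ᵇ b)) hctTriple-un

isSSHT-un : ∀ F → isSSHT (map (map un) F) ≡ isSSYT F
isSSHT-un = isTableau-map rowPair-un (λ a b → ∨-false (a <ᵇ b) (a ≡ᵇ b))

hqCoeff-unprimed : ∀ β v → hqCoeff β v [] ≡ csCoeff β v
hqCoeff-unprimed β v = trans (hqCoeff≡ β v [])
  (trans (hookCoeff-unprimed isHCT isHCT-un β v) (sym (length-filter _ (fillings (range1 (length v)) β))))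

hsCoeff-unprimed : ∀ μ v → hsCoeff μ v [] ≡ schurCoeff μ v
hsCoeff-unprimed μ v = trans (hsCoeff≡ μ v [])
  (trans (hookCoeff-unprimed isSSHT isSSHT-un μ v) (sym (length-filter _ (fillings (range1 (length v)) μ))))

-- Exchanging x = un n and y = pr 1 in one cell

data Swap (n : ℕ) : HL → HL → Set where
  x→y : Swap n (un n) (pr 1)
  y→x : Swap n (pr 1) (un n)

-- Since n is the largest unprimed index and primed indices start at 1, a letter other than x and y
-- lies below both or above both. Hence no comparison with it distinguishes x from y.
data Outside (n : ℕ) : HL → Set where
  low  : ∀ {a} → a < n → Outside n (un a)
  high : ∀ {b} → Outside n (pr (suc (suc b)))

data Zone (n : ℕ) : HL → Set where
  inside  : ∀ {e e′} → Swap n e e′ → Zone n e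
  outside : ∀ {e} → Outside n e → Zone n e

<ᵇ-irrefl : ∀ n → (n <ᵇ n) ≡ false
<ᵇ-irrefl zero = refl
<ᵇ-irrefl (suc n) = <ᵇ-irrefl n

≤ᵇ-refl : ∀ n → (n ≤ᵇ n) ≡ true
≤ᵇ-refl zero = refl
≤ᵇ-refl (suc n) = trans (suc-≤ᵇ n n) (≤ᵇ-refl n)

<⇒<ᵇ : ∀ {m n} → m < n → (m <ᵇ n) ≡ true
<⇒<ᵇ {zero} (s≤s _) = refl
<⇒<ᵇ {suc m} (s≤s m<n) = <⇒<ᵇ m<n

<⇒≤ᵇ : ∀ {m n} → m < n → (m ≤ᵇ n) ≡ true
<⇒≤ᵇ {zero} _ = refl
<⇒≤ᵇ {suc m} {suc n} (s≤s m<n) = trans (suc-≤ᵇ m n) (<⇒≤ᵇ m<n)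

<⇒≯ᵇ : ∀ {m n} → m < n → (n <ᵇ m) ≡ false
<⇒≯ᵇ {zero} _ = refl
<⇒≯ᵇ {suc m} (s≤s m<n) = <⇒≯ᵇ m<n

<⇒≱ᵇ : ∀ {m n} → m < n → (n ≤ᵇ m) ≡ false
<⇒≱ᵇ {zero} (s≤s _) = refl
<⇒≱ᵇ {suc m} {suc n} (s≤s m<n) = trans (suc-≤ᵇ n m) (<⇒≱ᵇ m<n)

related? : (X → X → Bool) → Maybe X → Maybe X → Bool
related? r (just a) (just b) = r a b
related? r _ _ = true

module _ {n : ℕ} where

  private
    Out Any : Maybe HL → Set
    Out = MAll.All (Outside n)
    Any = MAll.All (Zone n)

  row-left : ∀ {a a′ B} → Swap n a a′ → Out B →
    related? rowPair (just a) B ≡ true → related? rowPair (just a′) B ≡ true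
  row-left _ nothing _ = refl
  row-left x→y (just (low p)) h rewrite <⇒≯ᵇ p | ≢⇒≡ᵇ-false (ℕ.>⇒≢ p) = h
  row-left x→y (just high) h = refl
  row-left y→x (just (low p)) ()
  row-left y→x (just high) h = refl

  -- A left neighbour y is excluded by the hypothesis, as neither x nor y may follow y in a row; a
  -- left neighbour x may be followed by either.
  row-right : ∀ {A b b′} → Swap n b b′ → Any A →
    related? rowPair A (just b) ≡ true → related? rowPair A (just b′) ≡ true
  row-right _ nothing _ = refl
  row-right x→y (just (inside x→y)) h = refl
  row-right x→y (just (inside y→x)) ()
  row-right x→y (just (outside (low p))) h = refl
  row-right x→y (just (outside high)) ()
  row-right y→x (just (inside x→y)) h rewrite <ᵇ-irrefl n | ≡ᵇ-refl n = refl
  row-right y→x (just (inside y→x)) ()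
  row-right y→x (just (outside (low p))) h rewrite <⇒<ᵇ p = refl
  row-right y→x (just (outside high)) ()

  -- If the upper cell contains x or y, the hypothesis makes it y, and y may stand above x as well
  -- as above y.
  col-lower : ∀ {a a′ B} → Swap n a a′ → Any B →
    related? colPair (just a) B ≡ true → related? colPair (just a′) B ≡ true
  col-lower _ nothing _ = refl
  col-lower x→y (just (inside x→y)) h rewrite <ᵇ-irrefl n | ≡ᵇ-refl n = h
  col-lower x→y (just (inside y→x)) h = refl
  col-lower x→y (just (outside (low p))) h rewrite <⇒≯ᵇ p | ≢⇒≡ᵇ-false (ℕ.>⇒≢ p) = h
  col-lower x→y (just (outside high)) h = refl
  col-lower y→x (just (inside x→y)) ()
  col-lower y→x (just (inside y→x)) h = refl
  col-lower y→x (just (outside (low p))) ()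
  col-lower y→x (just (outside high)) h = refl

  col-upper : ∀ {A b b′} → Swap n b b′ → Out A →
    related? colPair A (just b) ≡ true → related? colPair A (just b′) ≡ true
  col-upper _ nothing _ = refl
  col-upper x→y (just (low p)) h = refl
  col-upper x→y (just high) ()
  col-upper y→x (just (low p)) h rewrite <⇒<ᵇ p = refl
  col-upper y→x (just high) ()

  -- x ≥ B and y > B are the same condition on B. The conclusions x > C and y ≥ C differ exactly at
  -- C = x and C = y, so C is required to be outside.
  triple-first : ∀ {a a′ B C} → Swap n a a′ → Any B → Out C →
    hctTriple (just a) B C ≡ true → hctTriple (just a′) B C ≡ true
  triple-first x→y nothing _ h = refl
  triple-first x→y (just (inside x→y)) C h rewrite ≤ᵇ-refl n = third C h
    where
    third : ∀ {C} → Out C → (un n >L∞ C) ≡ true → (pr 1 ≥L∞ C) ≡ true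
    third (just (low _)) _ = refl
  triple-first x→y (just (inside y→x)) _ h = refl
  triple-first x→y (just (outside (low p))) C h rewrite <⇒≤ᵇ p = third C h
    where
    third : ∀ {C} → Out C → (un n >L∞ C) ≡ true → (pr 1 ≥L∞ C) ≡ true
    third (just (low _)) _ = refl
  triple-first x→y (just (outside high)) _ h = refl
  triple-first y→x nothing _ h = refl
  triple-first y→x (just (inside x→y)) C h rewrite ≤ᵇ-refl n = third C h
    where
    third : ∀ {C} → Out C → (pr 1 ≥L∞ C) ≡ true → (un n >L∞ C) ≡ true
    third (just (low p)) _ = <⇒<ᵇ p
  triple-first y→x (just (inside y→x)) _ h = refl
  triple-first y→x (just (outside (low p))) C h rewrite <⇒≤ᵇ p = third C h
    where
    third : ∀ {C} → Out C → (pr 1 ≥L∞ C) ≡ true → (un n >L∞ C) ≡ true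
    third (just (low p)) _ = <⇒<ᵇ p
  triple-first y→x (just (outside high)) _ h = refl

  -- Here A lies one column to the right of the exchanged cell, hence outside R, and its comparison
  -- with B is the same for x and y.
  triple-second : ∀ {A b b′ C} → Swap n b b′ → Out A →
    hctTriple A (just b) C ≡ true → hctTriple A (just b′) C ≡ true
  triple-second _ nothing h = refl
  triple-second x→y (just (low p)) h = refl
  triple-second x→y (just high) h = h
  triple-second y→x (just (low p)) h rewrite <⇒≱ᵇ p = refl
  triple-second y→x (just high) h = h

  -- A may itself be x or y: x > C fails and y ≥ C holds, whichever of the two letters C is.
  triple-third : ∀ {A B c c′} → Swap n c c′ → Any A →
    hctTriple A B (just c) ≡ true → hctTriple A B (just c′) ≡ true
  triple-third _ nothing h = refl
  triple-third x→y (just (inside x→y)) h rewrite <ᵇ-irrefl n = h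
  triple-third {B = B} x→y (just (inside y→x)) h with pr 1 >L∞ B
  ... | true = refl
  ... | false = refl
  triple-third x→y (just (outside (low p))) h rewrite <⇒≯ᵇ p = h
  triple-third {B = B} x→y (just (outside (high {b}))) h with pr (suc (suc b)) >L∞ B
  ... | true = refl
  ... | false = refl
  triple-third y→x (just (inside x→y)) h rewrite <ᵇ-irrefl n = h
  triple-third {B = B} y→x (just (inside y→x)) h with pr 1 >L∞ B
  ... | true = refl
  ... | false = refl
  triple-third y→x (just (outside (low p))) h rewrite <⇒≯ᵇ p = h
  triple-third {B = B} y→x (just (outside (high {b}))) h with pr (suc (suc b)) >L∞ B
  ... | true = refl
  ... | false = refl

  record SwappedAt (i c : ℕ) (h h′ : ℕ → ℕ → Maybe HL) : Set where
    field
      {old new} : HL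
      swap      : Swap n old new
      before    : h i c ≡ just old
      after     : h′ i c ≡ just new
      elsewhere : ∀ i′ c′ → i′ ≢ i ⊎ c′ ≢ c → h′ i′ c′ ≡ h i′ c′
      zone      : ∀ i′ c′ → Any (h i′ c′)
      right     : ∀ i′ c′ → c < c′ → Out (h i′ c′)

  module _ {i c : ℕ} {h h′ : ℕ → ℕ → Maybe HL} (swapped : SwappedAt i c h h′) where
    open SwappedAt swapped

    rows-preserved : (∀ i c → related? rowPair (h i c) (h i (suc c)) ≡ true) →
      ∀ i c → related? rowPair (h′ i c) (h′ i (suc c)) ≡ true
    rows-preserved ok i′ c′ with i′ ℕ.≟ i | c′ ℕ.≟ c | suc c′ ℕ.≟ c
    ... | no i′≢i | _ | _
      rewrite elsewhere i′ c′ (inj₁ i′≢i) | elsewhere i′ (suc c′) (inj₁ i′≢i) = ok i′ c′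
    ... | yes refl | yes refl | _ rewrite after | elsewhere i (suc c) (inj₂ ℕ.1+n≢n) =
      row-left swap (right i (suc c) ℕ.≤-refl)
        (subst (λ A → related? rowPair A (h i (suc c)) ≡ true) before (ok i c))
    ... | yes refl | no c′≢c | yes refl rewrite after | elsewhere i c′ (inj₂ c′≢c) =
      row-right swap (zone i c′) (subst (λ B → related? rowPair (h i c′) B ≡ true) before (ok i c′))
    ... | yes refl | no c′≢c | no sc′≢c
      rewrite elsewhere i c′ (inj₂ c′≢c) | elsewhere i (suc c′) (inj₂ sc′≢c) = ok i c′

    -- Stated one column at a time, because an SSHT restricts every column but an HCT only the
    -- leftmost.
    column-preserved : ∀ c′ → (c′ ≡ c → ∀ i′ → i′ < i → Out (h i′ c′)) →
      (∀ i → related? colPair (h i c′) (h (suc i) c′) ≡ true) →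
      ∀ i → related? colPair (h′ i c′) (h′ (suc i) c′) ≡ true
    column-preserved c′ lowest ok i′ with c′ ℕ.≟ c | i′ ℕ.≟ i | suc i′ ℕ.≟ i
    ... | no c′≢c | _ | _
      rewrite elsewhere i′ c′ (inj₂ c′≢c) | elsewhere (suc i′) c′ (inj₂ c′≢c) = ok i′
    ... | yes refl | yes refl | _ rewrite after | elsewhere (suc i) c (inj₁ ℕ.1+n≢n) =
      col-lower swap (zone (suc i) c)
        (subst (λ A → related? colPair A (h (suc i) c) ≡ true) before (ok i))
    ... | yes refl | no i′≢i | yes refl rewrite after | elsewhere i′ c (inj₁ i′≢i) =
      col-upper swap (lowest refl i′ ℕ.≤-refl)
        (subst (λ B → related? colPair (h i′ c) B ≡ true) before (ok i′))
    ... | yes refl | no i′≢i | no si′≢i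
      rewrite elsewhere i′ c (inj₁ i′≢i) | elsewhere (suc i′) c (inj₁ si′≢i) = ok i′

    -- The exchanged cell can be any of the three entries of a triple. Only as the first entry,
    -- which forces its column to be a successor, does it need that no cell of R lies above it.
    triples-preserved : (∀ c′ → c ≡ suc c′ → ∀ j → i < j → Out (h j c)) →
      (∀ i j c → i < j → hctTriple (h i (suc c)) (h j c) (h j (suc c)) ≡ true) →
      ∀ i j c → i < j → hctTriple (h′ i (suc c)) (h′ j c) (h′ j (suc c)) ≡ true
    triples-preserved highest ok i′ j c′ i′<j with j ℕ.≟ i | i′ ℕ.≟ i | c′ ℕ.≟ c | suc c′ ℕ.≟ c
    -- The exchanged cell is the second entry, F̂(j,n).
    ... | yes refl | _ | yes refl | _
      rewrite after | elsewhere i′ (suc c) (inj₁ (ℕ.<⇒≢ i′<j)) | elsewhere i (suc c) (inj₂ ℕ.1+n≢n) =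
      triple-second {C = h i (suc c)} swap (right i′ (suc c) ℕ.≤-refl)
        (subst (λ B → hctTriple (h i′ (suc c)) B (h i (suc c)) ≡ true) before (ok i′ i c i′<j))
    -- The exchanged cell is the third entry, F̂(j,n+1).
    ... | yes refl | _ | no c′≢c | yes refl
      rewrite after | elsewhere i′ c (inj₁ (ℕ.<⇒≢ i′<j)) | elsewhere i c′ (inj₂ c′≢c) =
      triple-third {B = h i c′} swap (zone i′ c)
        (subst (λ C → hctTriple (h i′ c) (h i c′) C ≡ true) before (ok i′ i c′ i′<j))
    ... | yes refl | _ | no c′≢c | no sc′≢c
      rewrite elsewhere i′ (suc c′) (inj₁ (ℕ.<⇒≢ i′<j)) | elsewhere i c′ (inj₂ c′≢c)
            | elsewhere i (suc c′) (inj₂ sc′≢c) = ok i′ i c′ i′<j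
    -- The exchanged cell is the first entry, F̂(i,n+1).
    ... | no j≢i | yes refl | _ | yes refl
      rewrite after | elsewhere j c′ (inj₁ j≢i) | elsewhere j c (inj₁ j≢i) =
      triple-first swap (zone j c′) (highest c′ refl j i′<j)
        (subst (λ A → hctTriple A (h j c′) (h j c) ≡ true) before (ok i j c′ i′<j))
    ... | no j≢i | yes refl | _ | no sc′≢c
      rewrite elsewhere i (suc c′) (inj₂ sc′≢c) | elsewhere j c′ (inj₁ j≢i)
            | elsewhere j (suc c′) (inj₁ j≢i) = ok i j c′ i′<j
    ... | no j≢i | no i′≢i | _ | _
      rewrite elsewhere i′ (suc c′) (inj₁ i′≢i) | elsewhere j c′ (inj₁ j≢i)
            | elsewhere j (suc c′) (inj₁ j≢i) = ok i′ j c′ i′<j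

-- Tableau conditions in terms of F̂

related?-nothing : (r : X → X → Bool) (A : Maybe X) → related? r A nothing ≡ true
related?-nothing r nothing = refl
related?-nothing r (just a) = refl

related-nth⁻ : {r : X → X → Bool} (w : List X) → related r w ≡ true →
  ∀ c → related? r (nth w c) (nth w (suc c)) ≡ true
related-nth⁻ [] _ c = refl
related-nth⁻ (a ∷ []) _ zero = refl
related-nth⁻ (a ∷ []) _ (suc c) = refl
related-nth⁻ {r = r} (a ∷ b ∷ w) ok zero = proj₁ (∧-true⁻ (r a b) ok)
related-nth⁻ {r = r} (a ∷ b ∷ w) ok (suc c) = related-nth⁻ (b ∷ w) (proj₂ (∧-true⁻ (r a b) ok)) c

related-nth⁺ : {r : X → X → Bool} (w : List X) →
  (∀ c → related? r (nth w c) (nth w (suc c)) ≡ true) → related r w ≡ true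
related-nth⁺ [] _ = refl
related-nth⁺ (a ∷ []) _ = refl
related-nth⁺ (a ∷ b ∷ w) ok = ∧-true⁺ (ok 0) (related-nth⁺ (b ∷ w) (ok ∘ suc))

relatedPointwise-nth⁻ : {r : X → X → Bool} (lo up : List X) → relatedPointwise r lo up ≡ true →
  ∀ c → related? r (nth lo c) (nth up c) ≡ true
relatedPointwise-nth⁻ [] up _ c = refl
relatedPointwise-nth⁻ {r = r} (a ∷ lo) [] _ c = related?-nothing r (nth (a ∷ lo) c)
relatedPointwise-nth⁻ {r = r} (a ∷ lo) (b ∷ up) ok zero = proj₁ (∧-true⁻ (r a b) ok)
relatedPointwise-nth⁻ {r = r} (a ∷ lo) (b ∷ up) ok (suc c) =
  relatedPointwise-nth⁻ lo up (proj₂ (∧-true⁻ (r a b) ok)) c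

relatedPointwise-nth⁺ : {r : X → X → Bool} (lo up : List X) →
  (∀ c → related? r (nth lo c) (nth up c) ≡ true) → relatedPointwise r lo up ≡ true
relatedPointwise-nth⁺ [] up _ = refl
relatedPointwise-nth⁺ (a ∷ lo) [] _ = refl
relatedPointwise-nth⁺ (a ∷ lo) (b ∷ up) ok = ∧-true⁺ (ok 0) (relatedPointwise-nth⁺ lo up (ok ∘ suc))

rows⁻ : {r : X → X → Bool} (F : List (List X)) → all (related r) F ≡ true →
  ∀ i c → related? r (hat F i c) (hat F i (suc c)) ≡ true
rows⁻ [] _ i c = refl
rows⁻ {r = r} (w ∷ F) ok zero c = related-nth⁻ w (proj₁ (∧-true⁻ (related r w) ok)) c
rows⁻ {r = r} (w ∷ F) ok (suc i) c rewrite hat-∷ w F i c | hat-∷ w F i (suc c) =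
  rows⁻ F (proj₂ (∧-true⁻ (related r w) ok)) i c

rows⁺ : {r : X → X → Bool} (F : List (List X)) →
  (∀ i c → related? r (hat F i c) (hat F i (suc c)) ≡ true) → all (related r) F ≡ true
rows⁺ [] _ = refl
rows⁺ {r = r} (w ∷ F) ok = ∧-true⁺ (related-nth⁺ w (ok 0)) (rows⁺ F λ i c →
  subst (_≡ true) (cong₂ (related? r) (hat-∷ w F i c) (hat-∷ w F i (suc c))) (ok (suc i) c))

columns⁻ : {r : X → X → Bool} (F : List (List X)) → related (relatedPointwise r) F ≡ true →
  ∀ i c → related? r (hat F i c) (hat F (suc i) c) ≡ true
columns⁻ [] _ i c = refl
columns⁻ {r = r} (w ∷ []) _ zero c = related?-nothing r (nth w c)
columns⁻ (w ∷ []) _ (suc i) c = refl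
columns⁻ {r = r} (w ∷ w′ ∷ F) ok zero c =
  relatedPointwise-nth⁻ w w′ (proj₁ (∧-true⁻ (relatedPointwise r w w′) ok)) c
columns⁻ {r = r} (w ∷ w′ ∷ F) ok (suc i) c
  rewrite hat-∷ w (w′ ∷ F) i c | hat-∷ w (w′ ∷ F) (suc i) c =
  columns⁻ (w′ ∷ F) (proj₂ (∧-true⁻ (relatedPointwise r w w′) ok)) i c

columns⁺ : {r : X → X → Bool} (F : List (List X)) →
  (∀ i c → related? r (hat F i c) (hat F (suc i) c) ≡ true) → related (relatedPointwise r) F ≡ true
columns⁺ [] _ = refl
columns⁺ (w ∷ []) _ = refl
columns⁺ {r = r} (w ∷ w′ ∷ F) ok =
  ∧-true⁺ (relatedPointwise-nth⁺ w w′ (ok 0)) (columns⁺ (w′ ∷ F) λ i c →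
    subst (_≡ true) (cong₂ (related? r) (hat-∷ w (w′ ∷ F) i c) (hat-∷ w (w′ ∷ F) (suc i) c)) (ok (suc i) c))

-- `heads` skips empty rows, so its positions are row numbers only if all parts are positive. This
-- is where the shape has to be a composition.
nth-heads : (F : List (List X)) → IsComposition (map length F) → ∀ i → nth (heads F) i ≡ hat F i 0
nth-heads [] _ i = refl
nth-heads ([] ∷ F) (() ∷ _) i
nth-heads ((x ∷ w) ∷ F) _ zero = refl
nth-heads ((x ∷ w) ∷ F) (_ ∷ 0<F) (suc i) = trans (nth-heads F 0<F i) (sym (hat-∷ (x ∷ w) F i 0))

heads⁻ : {r : X → X → Bool} (F : List (List X)) → IsComposition (map length F) →
  related r (heads F) ≡ true → ∀ i → related? r (hat F i 0) (hat F (suc i) 0) ≡ true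
heads⁻ {r = r} F 0<F ok i =
  subst (_≡ true) (cong₂ (related? r) (nth-heads F 0<F i) (nth-heads F 0<F (suc i))) (related-nth⁻ (heads F) ok i)

heads⁺ : {r : X → X → Bool} (F : List (List X)) → IsComposition (map length F) →
  (∀ i → related? r (hat F i 0) (hat F (suc i) 0) ≡ true) → related r (heads F) ≡ true
heads⁺ {r = r} F 0<F ok = related-nth⁺ (heads F) λ i →
  subst (_≡ true) (sym (cong₂ (related? r) (nth-heads F 0<F i) (nth-heads F 0<F (suc i)))) (ok i)

all-∈⁻ : (p : X → Bool) {xs : List X} → all p xs ≡ true → ∀ {x} → x ∈ xs → p x ≡ true
all-∈⁻ p {x ∷ xs} ok (here refl) = proj₁ (∧-true⁻ (p x) ok)
all-∈⁻ p {x ∷ xs} ok (there x∈) = all-∈⁻ p (proj₂ (∧-true⁻ (p x) ok)) x∈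

all-∈⁺ : (p : X → Bool) (xs : List X) → (∀ {x} → x ∈ xs → p x ≡ true) → all p xs ≡ true
all-∈⁺ p [] ok = refl
all-∈⁺ p (x ∷ xs) ok = ∧-true⁺ (ok (here refl)) (all-∈⁺ p xs (ok ∘ there))

∈-rangeFrom⁺ : ∀ {a b j} → a ≤ j → j < b → j ∈ rangeFrom a b
∈-rangeFrom⁺ {a} {b} a≤j j<b =
  subst (_∈ rangeFrom a b) (ℕ.m+[n∸m]≡n a≤j) (Mem.∈-map⁺ (_+_ a) (Mem.∈-upTo⁺ (ℕ.∸-monoˡ-< j<b a≤j)))

∈-rangeFrom⁻ : ∀ a b {j} → j ∈ rangeFrom a b → a ≤ j
∈-rangeFrom⁻ a b j∈ with Mem.∈-map⁻ (_+_ a) j∈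
... | d , _ , refl = ℕ.m≤m+n a d

nth-just : (xs : List X) (i : ℕ) {x : X} → nth xs i ≡ just x → i < length xs
nth-just (x ∷ xs) zero _ = s≤s z≤n
nth-just (x ∷ xs) (suc i) eq = s≤s (nth-just xs i eq)

hat-just : (F : List (List X)) (i c : ℕ) {e : X} → hat F i c ≡ just e → i < length F × c < maxLen F
hat-just (w ∷ F) zero c eq = s≤s z≤n , ℕ.m≤n⇒m≤n⊔o _ (nth-just w c eq)
hat-just (w ∷ F) (suc i) c eq with hat-just F i c (trans (sym (hat-∷ w F i c)) eq)
... | i< , c< = s≤s i< , ℕ.m≤n⇒m≤o⊔n (length w) c<

-- `tripleOK` tests a finite range only. Beyond it the first or the second entry is ∞ and the
-- condition is vacuous: a first entry in column c + 1 gives c < m - 1, and a second entry in row j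
-- gives j < r.
triples⁻ : (F : List (List HL)) → tripleOK hctTriple F ≡ true →
  ∀ i j c → i < j → hctTriple (hat F i (suc c)) (hat F j c) (hat F j (suc c)) ≡ true
triples⁻ F ok i j c i<j with hat F i (suc c) in eqA | hat F j c in eqB
... | nothing | _ = refl
... | just (un a) | nothing = refl
... | just (pr a) | nothing = refl
... | just a | just b = subst (_≡ true) (cong₂ (λ A B → hctTriple A B (hat F j (suc c))) eqA eqB)
  (all-∈⁻ _ (all-∈⁻ _ (all-∈⁻ _ ok (Mem.∈-upTo⁺ (proj₁ (hat-just F i (suc c) eqA))))
    (∈-rangeFrom⁺ i<j (proj₁ (hat-just F j c eqB))))
    (Mem.∈-upTo⁺ (ℕ.∸-monoˡ-≤ 1 (proj₂ (hat-just F i (suc c) eqA)))))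

triples⁺ : (t : Maybe X → Maybe X → Maybe X → Bool) (F : List (List X)) →
  (∀ i j c → i < j → t (hat F i (suc c)) (hat F j c) (hat F j (suc c)) ≡ true) → tripleOK t F ≡ true
triples⁺ t F ok = all-∈⁺ _ (upTo (length F)) λ {i} _ → all-∈⁺ _ (rangeFrom (suc i) (length F)) λ {j} j∈ →
  all-∈⁺ _ (upTo (maxLen F ∸ 1)) λ {c} _ → ok i j c (∈-rangeFrom⁻ (suc i) (length F) j∈)

module _ {n : ℕ} {F G : List (List HL)} {i c : ℕ} (swapped : SwappedAt {n} i c (hat F) (hat G)) where

  private
    Out : Maybe HL → Set
    Out = MAll.All (Outside n)

  isSSHT-preserved : (∀ i′ → i′ < i → Out (hat F i′ c)) → isSSHT F ≡ true → isSSHT G ≡ true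
  isSSHT-preserved lowest ok with ∧-true⁻ (all hookRow F) ok
  ... | rows , columns = ∧-true⁺ (rows⁺ G (rows-preserved swapped (rows⁻ F rows)))
    (columns⁺ G λ i′ c′ → column-preserved swapped c′
      (λ { refl → lowest }) (λ i″ → columns⁻ F columns i″ c′) i′)

  isHCT-preserved : IsComposition (map length F) → IsComposition (map length G) →
    (c ≡ 0 → ∀ i′ → i′ < i → Out (hat F i′ c)) →
    (∀ c′ → c ≡ suc c′ → ∀ j → i < j → Out (hat F j c)) →
    isHCT F ≡ true → isHCT G ≡ true
  isHCT-preserved 0<F 0<G lowest highest ok with ∧-true⁻ (all hookRow F) ok
  ... | rows , ok′ with ∧-true⁻ (related colPair (heads F)) ok′
  ... | column , triples = ∧-true⁺ (rows⁺ G (rows-preserved swapped (rows⁻ F rows)))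
    (∧-true⁺ (heads⁺ G 0<G (column-preserved swapped 0 (λ { refl → lowest refl }) (heads⁻ F 0<F column)))
      (triples⁺ hctTriple G (triples-preserved swapped highest (triples⁻ F triples))))

-- Locating the cell to exchange

-- The Boolean selects the end, so that one search finds both the row inside a column and, with
-- `false`, the rightmost column.
data Extreme (Q : ℕ → Set) (i : ℕ) : Bool → Set where
  lowest  : (∀ j → j < i → Q j) → Extreme Q i true
  highest : (∀ j → i < j → Q j) → Extreme Q i false

findExtreme : ∀ b {P Q : ℕ → Set} → (∀ i → P i ⊎ Q i) → ∀ N → (∀ i → N ≤ i → Q i) →
  (∃ λ i → P i × Extreme Q i b) ⊎ (∀ i → Q i)
findExtreme b P⊎Q zero beyond = inj₂ λ i → beyond i z≤n
findExtreme true P⊎Q (suc N) beyond with P⊎Q 0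
... | inj₁ p₀ = inj₁ (0 , p₀ , lowest λ _ ())
... | inj₂ q₀ with findExtreme true (P⊎Q ∘ suc) N (λ i N≤i → beyond (suc i) (s≤s N≤i))
... | inj₁ (i , p , lowest below) =
  inj₁ (suc i , p , lowest λ { zero _ → q₀ ; (suc j) (s≤s j<i) → below j j<i })
... | inj₂ none = inj₂ λ { zero → q₀ ; (suc i) → none i }
findExtreme false {Q = Q} P⊎Q (suc N) beyond with P⊎Q N
... | inj₁ p = inj₁ (N , p , highest beyond)
... | inj₂ q = findExtreme false P⊎Q N from
  where
  from : ∀ i → N ≤ i → Q i
  from i N≤i with N ℕ.≟ i
  ... | yes refl = q
  ... | no N≢i = beyond i (ℕ.≤∧≢⇒< N≤i N≢i)

Cell : List (List Bool) → ℕ → ℕ → Set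
Cell M i c = hat M i c ≡ just true

cell? : ∀ M i c → Cell M i c ⊎ ¬ Cell M i c
cell? M i c with hat M i c
... | just true = inj₁ refl
... | just false = inj₂ λ ()
... | nothing = inj₂ λ ()

-- Refers only to the Boolean array marking R. An exchange of x and y leaves this array unchanged,
-- so the same cell is found again afterwards.
Corner : (ℕ → Bool) → List (List Bool) → ℕ → Set
Corner lowestIn M c =
  (∃ λ i → Cell M i c × Extreme (λ j → ¬ Cell M j c) i (lowestIn c)) ×
  Extreme (λ c′ → ∀ i → ¬ Cell M i c′) c false

findCorner : ∀ lowestIn M → ∃ (Corner lowestIn M) ⊎ (∀ c i → ¬ Cell M i c)
findCorner lowestIn M = findExtreme false
  (λ c → findExtreme (lowestIn c) (λ i → cell? M i c) (length M)
    λ i |M|≤i cell → ℕ.<⇒≱ (proj₁ (hat-just M i c cell)) |M|≤i)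
  (maxLen M) λ c m≤c i cell → ℕ.<⇒≱ (proj₂ (hat-just M i c cell)) m≤c

cornerPosition : ∀ lowestIn M → ∃ (Corner lowestIn M) ⊎ (∀ c i → ¬ Cell M i c) → Maybe (ℕ × ℕ)
cornerPosition lowestIn M (inj₁ (c , (i , _) , _)) = just (i , c)
cornerPosition lowestIn M (inj₂ _) = nothing

-- Changing the entry of a single cell

modify : (X → X) → List X → ℕ → List X
modify f [] i = []
modify f (x ∷ xs) zero = f x ∷ xs
modify f (x ∷ xs) (suc i) = x ∷ modify f xs i

modifyCell : (X → X) → List (List X) → ℕ → ℕ → List (List X)
modifyCell f F i c = modify (λ w → modify f w c) F i

modify-invol : {f : X → X} → (∀ x → f (f x) ≡ x) → ∀ xs i → modify f (modify f xs i) i ≡ xs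
modify-invol inv [] i = refl
modify-invol inv (x ∷ xs) zero = cong (_∷ xs) (inv x)
modify-invol inv (x ∷ xs) (suc i) = cong (x ∷_) (modify-invol inv xs i)

map-modify : {g : X → Y} {f : X → X} → (∀ x → g (f x) ≡ g x) → ∀ xs i → map g (modify f xs i) ≡ map g xs
map-modify inv [] i = refl
map-modify {g = g} inv (x ∷ xs) zero = cong (_∷ map g xs) (inv x)
map-modify {g = g} inv (x ∷ xs) (suc i) = cong (g x ∷_) (map-modify inv xs i)

length-modify : (f : X → X) (xs : List X) (i : ℕ) → length (modify f xs i) ≡ length xs
length-modify f [] i = refl
length-modify f (x ∷ xs) zero = refl
length-modify f (x ∷ xs) (suc i) = cong suc (length-modify f xs i)

All-modify : {P : X → Set} {f : X → X} → (∀ {x} → P x → P (f x)) → ∀ {xs} → All P xs → ∀ i → All P (modify f xs i)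
All-modify pf [] i = []
All-modify pf (p ∷ ps) zero = pf p ∷ ps
All-modify pf (p ∷ ps) (suc i) = p ∷ All-modify pf ps i

nth-modify : (f : X → X) (xs : List X) (i : ℕ) {x : X} → nth xs i ≡ just x → nth (modify f xs i) i ≡ just (f x)
nth-modify f (x ∷ xs) zero refl = refl
nth-modify f (x ∷ xs) (suc i) eq = nth-modify f xs i eq

nth-modify-≢ : (f : X → X) (xs : List X) (i j : ℕ) → j ≢ i → nth (modify f xs i) j ≡ nth xs j
nth-modify-≢ f [] i j _ = refl
nth-modify-≢ f (x ∷ xs) zero zero j≢i = ⊥-elim (j≢i refl)
nth-modify-≢ f (x ∷ xs) zero (suc j) _ = refl
nth-modify-≢ f (x ∷ xs) (suc i) zero _ = refl
nth-modify-≢ f (x ∷ xs) (suc i) (suc j) j≢i = nth-modify-≢ f xs i j (j≢i ∘ cong suc)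

hat-modifyCell : (f : X → X) (F : List (List X)) (i c : ℕ) {x : X} →
  hat F i c ≡ just x → hat (modifyCell f F i c) i c ≡ just (f x)
hat-modifyCell f (w ∷ F) zero c eq = nth-modify f w c eq
hat-modifyCell f (w ∷ F) (suc i) c eq = trans (hat-∷ w (modifyCell f F i c) i c)
  (hat-modifyCell f F i c (trans (sym (hat-∷ w F i c)) eq))

hat-modifyCell-≢ : (f : X → X) (F : List (List X)) (i c i′ c′ : ℕ) → i′ ≢ i ⊎ c′ ≢ c →
  hat (modifyCell f F i c) i′ c′ ≡ hat F i′ c′
hat-modifyCell-≢ f [] i c i′ c′ _ = refl
hat-modifyCell-≢ f (w ∷ F) zero c zero c′ (inj₁ 0≢0) = ⊥-elim (0≢0 refl)
hat-modifyCell-≢ f (w ∷ F) zero c zero c′ (inj₂ c′≢c) = nth-modify-≢ f w c c′ c′≢c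
hat-modifyCell-≢ f (w ∷ F) zero c (suc i′) c′ _ =
  trans (hat-∷ (modify f w c) F i′ c′) (sym (hat-∷ w F i′ c′))
hat-modifyCell-≢ f (w ∷ F) (suc i) c zero c′ _ = refl
hat-modifyCell-≢ f (w ∷ F) (suc i) c (suc i′) c′ ≢cell =
  trans (hat-∷ w (modifyCell f F i c) i′ c′)
    (trans (hat-modifyCell-≢ f F i c i′ c′ (shift ≢cell)) (sym (hat-∷ w F i′ c′)))
  where
  shift : suc i′ ≢ suc i ⊎ c′ ≢ c → i′ ≢ i ⊎ c′ ≢ c
  shift (inj₁ ≢i) = inj₁ (≢i ∘ cong suc)
  shift (inj₂ ≢c) = inj₂ ≢c

nth-All : {P : X → Set} {xs : List X} → All P xs → ∀ i → MAll.All P (nth xs i)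
nth-All [] i = nothing
nth-All (p ∷ ps) zero = just p
nth-All (p ∷ ps) (suc i) = nth-All ps i

hat-All : {P : X → Set} {F : List (List X)} → All (All P) F → ∀ i c → MAll.All P (hat F i c)
hat-All [] i c = nothing
hat-All (p ∷ ps) zero c = nth-All p c
hat-All {F = w ∷ F} (p ∷ ps) (suc i) c rewrite hat-∷ w F i c = hat-All ps i c

nth-All⁻ : {P : X → Set} (xs : List X) → (∀ i → MAll.All P (nth xs i)) → All P xs
nth-All⁻ [] ps = []
nth-All⁻ (x ∷ xs) ps with ps 0
... | just p = p ∷ nth-All⁻ xs (ps ∘ suc)

hat-All⁻ : {P : X → Set} (F : List (List X)) → (∀ i c → MAll.All P (hat F i c)) → All (All P) F
hat-All⁻ [] ps = []
hat-All⁻ {P = P} (w ∷ F) ps =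
  nth-All⁻ w (ps 0) ∷ hat-All⁻ F λ i c → subst (MAll.All P) (hat-∷ w F i c) (ps (suc i) c)

-- The change of the count, with both sides moved so that no subtraction occurs.
count-modifyCell : (q : X → Bool) (f : X → X) (F : List (List X)) (i c : ℕ) {x : X} → hat F i c ≡ just x →
  (if q x then 1 else 0) + count q (modifyCell f F i c) ≡ (if q (f x) then 1 else 0) + count q F
count-modifyCell q f (w ∷ F) zero c {x} eq = begin
  ⟦ q x ⟧ + (# (modify f w c) + count q F)  ≡⟨ ℕ.+-assoc ⟦ q x ⟧ _ _ ⟨
  ⟦ q x ⟧ + # (modify f w c) + count q F    ≡⟨ cong (_+ count q F) (row w c eq) ⟩
  ⟦ q (f x) ⟧ + # w + count q F             ≡⟨ ℕ.+-assoc ⟦ q (f x) ⟧ _ _ ⟩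
  ⟦ q (f x) ⟧ + (# w + count q F)           ∎
  where
  open ≡-Reasoning
  ⟦_⟧ : Bool → ℕ
  ⟦ b ⟧ = if b then 1 else 0

  # : List _ → ℕ
  # w = length (filterᵇ q w)

  #-∷ : ∀ x w → # (x ∷ w) ≡ ⟦ q x ⟧ + # w
  #-∷ x w with q x
  ... | true = refl
  ... | false = refl

  row : ∀ w c {x} → nth w c ≡ just x → ⟦ q x ⟧ + # (modify f w c) ≡ ⟦ q (f x) ⟧ + # w
  row (y ∷ w) zero refl rewrite #-∷ y w | #-∷ (f y) w =
    ℕ+.x∙yz≈y∙xz ⟦ q y ⟧ ⟦ q (f y) ⟧ (# w)
  row (y ∷ w) (suc c) {x} eq rewrite #-∷ y w | #-∷ y (modify f w c) =
    trans (ℕ+.x∙yz≈y∙xz ⟦ q x ⟧ ⟦ q y ⟧ _)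
      (trans (cong (_+_ ⟦ q y ⟧) (row w c eq)) (ℕ+.x∙yz≈y∙xz ⟦ q y ⟧ ⟦ q (f x) ⟧ _))
count-modifyCell q f (w ∷ F) (suc i) c {x} eq =
  trans (ℕ+.x∙yz≈y∙xz (if q x then 1 else 0) (length (filterᵇ q w)) _)
    (trans (cong (_+_ (length (filterᵇ q w))) (count-modifyCell q f F i c (trans (sym (hat-∷ w F i c)) eq)))
      (ℕ+.x∙yz≈y∙xz (length (filterᵇ q w)) (if q (f x) then 1 else 0) _))

toggle : ℕ → HL → HL
toggle n (un a) = if a ≡ᵇ n then pr 1 else un a
toggle n (pr zero) = pr zero
toggle n (pr (suc zero)) = un n
toggle n (pr (suc (suc b))) = pr (suc (suc b))

toggle-invol : ∀ n e → toggle n (toggle n e) ≡ e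
toggle-invol n (un a) with a ≡ᵇ n in eq
... | true = cong un (sym (≡ᵇ-sound eq))
... | false rewrite eq = refl
toggle-invol n (pr zero) = refl
toggle-invol n (pr (suc zero)) rewrite ≡ᵇ-refl n = refl
toggle-invol n (pr (suc (suc b))) = refl

inRegion : ℕ → HL → Bool
inRegion n e = (un n =L e) ∨ (pr 1 =L e)

inRegion-toggle : ∀ n e → inRegion n (toggle n e) ≡ inRegion n e
inRegion-toggle n (un a) with a ≡ᵇ n in eq
... | true rewrite trans (≡ᵇ-sym n a) eq = refl
... | false = refl
inRegion-toggle n (pr zero) = refl
inRegion-toggle n (pr (suc zero)) rewrite ≡ᵇ-refl n = refl
inRegion-toggle n (pr (suc (suc b))) = refl

classify : ∀ {k l e} → InAlphabet (suc k) (suc l) e →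
  (inRegion (suc k) e ≡ true × Swap (suc k) e (toggle (suc k) e)) ⊎
  (inRegion (suc k) e ≡ false × Outside (suc k) e)
classify {k} (un {i} i≤k) with i ℕ.≟ k
... | yes refl rewrite ≡ᵇ-refl k = inj₁ (refl , x→y)
... | no i≢k rewrite ≢⇒≡ᵇ-false (i≢k ∘ sym) = inj₂ (refl , low (s≤s (ℕ.≤∧≢⇒< (ℕ.≤-pred i≤k) i≢k)))
classify (pr {zero} _) = inj₁ (refl , y→x)
classify (pr {suc j} _) = inj₂ (refl , high)

toggle-InAlphabet : ∀ {k l e} → InAlphabet (suc k) (suc l) e → InAlphabet (suc k) (suc l) (toggle (suc k) e)
toggle-InAlphabet {k} (un {i} i≤k) with i ≡ᵇ k
... | true = pr (s≤s z≤n)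
... | false = un i≤k
toggle-InAlphabet {k} (pr {zero} _) = un ℕ.≤-refl
toggle-InAlphabet (pr {suc j} j<l) = pr j<l

-- The sign-reversing involution

-- What one filling with cx letters x and cy letters y contributes to the alternating sum in degree
-- a: its sign (-1)^cx if cx + cy = a and the Boolean holds, and 0 otherwise.
signedIndicator : Bool → ℕ → ℕ → ℕ → ℤ
signedIndicator b a cx cy = C a (λ i j → sgn i ℤ.* 𝟙 (b ∧ (cx ≡ᵇ i) ∧ (cy ≡ᵇ j)))

signedIndicator-false : ∀ a cx cy → signedIndicator false a cx cy ≡ + 0
signedIndicator-false a cx cy = trans (C-cong a λ i _ _ → ℤ.*-zeroʳ (sgn i)) (C-0 a)

signedIndicator-true : ∀ a cx cy → signedIndicator true a cx cy ≡ (if cx + cy ≡ᵇ a then sgn cx else + 0)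
signedIndicator-true zero zero zero = C-zero _
signedIndicator-true zero zero (suc cy) = C-zero _
signedIndicator-true zero (suc cx) cy = C-zero _
signedIndicator-true (suc a) zero cy = trans (C-suc a _) (trans
  (cong (ℤ._+_ (+ 1 ℤ.* 𝟙 (cy ≡ᵇ suc a))) (trans (C-cong a λ i _ _ → ℤ.*-zeroʳ (sgn (suc i))) (C-0 a)))
  head-term)
  where
  head-term : + 1 ℤ.* 𝟙 (cy ≡ᵇ suc a) ℤ.+ + 0 ≡ (if cy ≡ᵇ suc a then + 1 else + 0)
  head-term with cy ≡ᵇ suc a
  ... | true = refl
  ... | false = refl
signedIndicator-true (suc a) (suc cx) cy = begin
  signedIndicator true (suc a) (suc cx) cy
    ≡⟨ trans (C-suc a _) (ℤ.+-identityˡ _) ⟩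
  C a (λ i j → - sgn i ℤ.* 𝟙 ((cx ≡ᵇ i) ∧ (cy ≡ᵇ j)))
    ≡⟨ C-cong a (λ i j _ → sym (ℤ.neg-distribˡ-* (sgn i) _)) ⟩
  C a (λ i j → - (sgn i ℤ.* 𝟙 ((cx ≡ᵇ i) ∧ (cy ≡ᵇ j))))
    ≡⟨ C-neg a ⟩
  - signedIndicator true a cx cy
    ≡⟨ cong -_ (signedIndicator-true a cx cy) ⟩
  - (if cx + cy ≡ᵇ a then sgn cx else + 0)
    ≡⟨ push (cx + cy ≡ᵇ a) ⟩
  (if cx + cy ≡ᵇ a then - sgn cx else + 0) ∎
  where
  open ≡-Reasoning
  push : ∀ b → - (if b then sgn cx else + 0) ≡ (if b then - sgn cx else + 0)
  push true = refl
  push false = refl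

-- Replacing one y by x keeps cx + cy and changes the parity of cx.
signedIndicator-swap : ∀ b a cx cy → signedIndicator b a (suc cx) cy ≡ - signedIndicator b a cx (suc cy)
signedIndicator-swap false a cx cy =
  trans (signedIndicator-false a (suc cx) cy) (cong -_ (sym (signedIndicator-false a cx (suc cy))))
signedIndicator-swap true a cx cy
  rewrite signedIndicator-true a (suc cx) cy | signedIndicator-true a cx (suc cy) | ℕ.+-suc cx cy
  with suc (cx + cy) ≡ᵇ a
... | true = refl
... | false = refl

signedIndicator-empty : ∀ b a → signedIndicator b (suc a) 0 0 ≡ + 0
signedIndicator-empty false a = signedIndicator-false (suc a) 0 0
signedIndicator-empty true a = signedIndicator-true (suc a) 0 0

bool-iff : ∀ {a b} → (a ≡ true → b ≡ true) → (b ≡ true → a ≡ true) → a ≡ b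
bool-iff {true} {b} a⇒b _ = sym (a⇒b refl)
bool-iff {false} {true} _ b⇒a = b⇒a refl
bool-iff {false} {false} _ _ = refl

toggled-cell : ∀ {k l A} → MAll.All (InAlphabet (suc k) (suc l)) A → Maybe.map (inRegion (suc k)) A ≡ just true →
  ∃ λ e → A ≡ just e × Swap (suc k) e (toggle (suc k) e)
toggled-cell (just e∈) inside-e with classify e∈
... | inj₁ (_ , swap) = _ , refl , swap
... | inj₂ (outside-e , _) with trans (sym outside-e) (Maybe.just-injective inside-e)
... | ()

untoggled-cell : ∀ {k l A} → MAll.All (InAlphabet (suc k) (suc l)) A → Maybe.map (inRegion (suc k)) A ≢ just true →
  MAll.All (Outside (suc k)) A
untoggled-cell nothing _ = nothing
untoggled-cell (just e∈) outside-e with classify e∈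
... | inj₁ (inside-e , _) = ⊥-elim (outside-e (cong just inside-e))
... | inj₂ (_ , out) = just out

toZone : ∀ {k l e} → InAlphabet (suc k) (suc l) e → Zone (suc k) e
toZone e∈ with classify e∈
... | inj₁ (_ , swap) = inside swap
... | inj₂ (_ , out) = outside out

mapExtreme : ∀ {P Q : ℕ → Set} {i b} → (∀ j → P j → Q j) → Extreme P i b → Extreme Q i b
mapExtreme P⇒Q (lowest below) = lowest λ j j<i → P⇒Q j (below j j<i)
mapExtreme P⇒Q (highest above) = highest λ j i<j → P⇒Q j (above j i<j)

-- Separates the counts of x and y, the only ones that an exchange alters, from everything that it
-- leaves fixed.
hookContentOK-split : ∀ b v i j u F → b ∧ hookContentOK (v ++ i ∷ []) (j ∷ u) F ≡
  (b ∧ matches (countUn F) v ∧ matches (countPr F ∘ suc) u) ∧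
  (countUn F (suc (length v)) ≡ᵇ i) ∧ (countPr F 1 ≡ᵇ j)
hookContentOK-split b v i j u F = trans
  (cong (b ∧_) (cong₂ _∧_ (matches-snoc (countUn F) v i) (matches-∷ (countPr F) j u)))
  (rearrange b (matches (countUn F) v) _ _ _)
  where
  rearrange : ∀ a b c d e → a ∧ (b ∧ c) ∧ (d ∧ e) ≡ (a ∧ b ∧ e) ∧ c ∧ d
  rearrange false b c d e = refl
  rearrange true false c d e = refl
  rearrange true true c d e = trans (sym (∧-assoc c d e)) (∧-comm (c ∧ d) e)

-- `lowestIn c` says whether the lowest or the highest cell of R is taken in column c: constantly
-- `true` for an SSHT, true only at column 0 for an HCT.
module Cancellation (valid : List (List HL) → Bool) (lowestIn : ℕ → Bool) (β : List ℕ)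
  (preserved : ∀ {n F G i c} → map length F ≡ β → map length G ≡ β →
    SwappedAt {n} i c (hat F) (hat G) →
    Extreme (λ j → MAll.All (Outside n) (hat F j c)) i (lowestIn c) →
    valid F ≡ true → valid G ≡ true) where

  module _ (k l : ℕ) where

    private
      n : ℕ
      n = suc k

      L : List HL
      L = alphabet n (suc l)

    region : List (List HL) → List (List Bool)
    region = map (map (inRegion n))

    toggleAt : Maybe (ℕ × ℕ) → List (List HL) → List (List HL)
    toggleAt nothing F = F
    toggleAt (just (i , c)) F = modifyCell (toggle n) F i c

    position : List (List Bool) → Maybe (ℕ × ℕ)
    position M = cornerPosition lowestIn M (findCorner lowestIn M)

    τ : List (List HL) → List (List HL)
    τ F = toggleAt (position (region F)) F

    region-toggleAt : ∀ p F → region (toggleAt p F) ≡ region F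
    region-toggleAt nothing F = refl
    region-toggleAt (just (i , c)) F = map-modify (λ w → map-modify (inRegion-toggle n) w c) F i

    toggleAt-invol : ∀ p F → toggleAt p (toggleAt p F) ≡ F
    toggleAt-invol nothing F = refl
    toggleAt-invol (just (i , c)) F = modify-invol (λ w → modify-invol (toggle-invol n) w c) F i

    τ-invol : ∀ F → τ (τ F) ≡ F
    -- Since `τ F` has the same region as F, the second application changes the same cell.
    τ-invol F = trans
      (cong (λ M → toggleAt (position M) (τ F))
        (region-toggleAt (position (region F)) F))
      (toggleAt-invol (position (region F)) F)

    toggleAt-∈ : ∀ p {F} → F ∈ fillings L β → toggleAt p F ∈ fillings L β
    toggleAt-∈ nothing F∈ = F∈
    toggleAt-∈ (just (i , c)) {F} F∈ with ∈-fillings⁻ L β F∈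
    ... | shape , F∈L = subst (λ γ → modifyCell (toggle n) F i c ∈ fillings L γ)
      (trans (map-modify (λ w → length-modify (toggle n) w c) F i) shape)
      (∈-fillings⁺ (All-modify (λ w∈ → All-modify
        (λ e∈ → ∈-alphabet⁺ (toggle-InAlphabet (∈-alphabet⁻ n (suc l) e∈))) w∈ c) F∈L i))

    τ-∈ : ∀ {F} → F ∈ fillings L β → τ F ∈ fillings L β
    τ-∈ {F} = toggleAt-∈ (position (region F))

    module _ {F : List (List HL)} (F∈ : F ∈ fillings L β) where

      private
        cells : ∀ i c → MAll.All (InAlphabet n (suc l)) (hat F i c)
        cells = hat-All (letters n (suc l) (proj₂ (∈-fillings⁻ L β F∈)))

      cell-swap : ∀ {i c} → Cell (region F) i c → ∃ λ e → hat F i c ≡ just e × Swap n e (toggle n e)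
      cell-swap {i} {c} cell = toggled-cell (cells i c) (trans (sym (hat-map (inRegion n) F i c)) cell)

      non-cell-outside : ∀ {i c} → ¬ Cell (region F) i c → MAll.All (Outside n) (hat F i c)
      non-cell-outside {i} {c} ¬cell =
        untoggled-cell (cells i c) (¬cell ∘ trans (hat-map (inRegion n) F i c))

      swappedAt : ∀ {i c} → Cell (region F) i c → Extreme (λ c′ → ∀ i → ¬ Cell (region F) i c′) c false →
        SwappedAt i c (hat F) (hat (modifyCell (toggle n) F i c))
      swappedAt {i} {c} cell (highest right) with cell-swap {i} {c} cell
      ... | e , hat≡e , swap = record
        { swap = swap
        ; before = hat≡e
        ; after = hat-modifyCell (toggle n) F i c hat≡e
        ; elsewhere = hat-modifyCell-≢ (toggle n) F i c
        ; zone = λ i′ c′ → MAll.map toZone (cells i′ c′)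
        ; right = λ i′ c′ c<c′ → non-cell-outside {i′} {c′} (right c′ c<c′ i′)
        }

      τ-valid : valid F ≡ true → valid (τ F) ≡ true
      τ-valid ok with findCorner lowestIn (region F)
      ... | inj₂ _ = ok
      ... | inj₁ (c , (i , cell , extreme) , right) = preserved shape
        (trans (map-modify (λ w → length-modify (toggle n) w c) F i) shape)
        (swappedAt cell right) (mapExtreme (λ j → non-cell-outside {j} {c}) extreme) ok
        where
        shape = proj₁ (∈-fillings⁻ L β F∈)

    -- The converse implication is the first one applied to `τ F`, because τ is an involution.
    valid-τ : ∀ {F} → F ∈ fillings L β → valid (τ F) ≡ valid F
    valid-τ {F} F∈ = bool-iff
      (λ ok → subst (λ G → valid G ≡ true) (τ-invol F) (τ-valid (τ-∈ F∈) ok)) (τ-valid F∈)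

  module _ (v u : List ℕ) (a : ℕ) where

    private
      k l n : ℕ
      k = length v
      l = length u
      n = suc k

      L : List HL
      L = alphabet n (suc l)

    remaining : List (List HL) → Bool
    remaining F = matches (countUn F) v ∧ matches (countPr F ∘ suc) u

    signedWeight : List (List HL) → ℤ
    signedWeight F = signedIndicator (valid F ∧ remaining F) (suc a) (countUn F n) (countPr F 1)

    -- The count equation holds for every predicate q. Taken at x and at y it gives the change of
    -- sign, and at each other letter it shows that the remaining content is unchanged.
    signedWeight-swap : ∀ {F G e e′} → Swap n e e′ → valid G ≡ valid F →
      (∀ q → (if q e then 1 else 0) + count q G ≡ (if q e′ then 1 else 0) + count q F) →
      signedWeight G ≡ - signedWeight F
    signedWeight-swap {F} {G} swap valid≡ counts =
      trans (cong (λ b → signedIndicator b (suc a) (countUn G n) (countPr G 1)) (cong₂ _∧_ valid≡ remaining≡))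
        (main swap counts)
      where
      un-other : ∀ {e e′} → Swap n e e′ → (∀ q → (if q e then 1 else 0) + count q G ≡ (if q e′ then 1 else 0) + count q F) →
        ∀ i → i < k → countUn G (suc i) ≡ countUn F (suc i)
      un-other x→y counts i i<k with counts (un (suc i) =L_)
      ... | eq rewrite ≢⇒≡ᵇ-false (ℕ.<⇒≢ i<k) = eq
      un-other y→x counts i i<k with counts (un (suc i) =L_)
      ... | eq rewrite ≢⇒≡ᵇ-false (ℕ.<⇒≢ i<k) = eq

      pr-other : ∀ {e e′} → Swap n e e′ → (∀ q → (if q e then 1 else 0) + count q G ≡ (if q e′ then 1 else 0) + count q F) →
        ∀ j → countPr G (suc (suc j)) ≡ countPr F (suc (suc j))
      pr-other x→y counts j = counts (pr (suc (suc j)) =L_)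
      pr-other y→x counts j = counts (pr (suc (suc j)) =L_)

      remaining≡ : remaining G ≡ remaining F
      remaining≡ = cong₂ _∧_ (matches-cong v (un-other swap counts)) (matches-cong u λ j _ → pr-other swap counts j)

      main : ∀ {e e′} → Swap n e e′ → (∀ q → (if q e then 1 else 0) + count q G ≡ (if q e′ then 1 else 0) + count q F) →
        signedIndicator (valid F ∧ remaining F) (suc a) (countUn G n) (countPr G 1) ≡ - signedWeight F
      main x→y counts with counts (un n =L_) | counts (pr 1 =L_)
      ... | un-eq | pr-eq rewrite ≡ᵇ-refl k | pr-eq | sym un-eq =
        trans (sym (ℤ.neg-involutive _)) (cong -_ (sym
          (signedIndicator-swap (valid F ∧ remaining F) (suc a) (countUn G n) (countPr F 1))))
      main y→x counts with counts (un n =L_) | counts (pr 1 =L_)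
      ... | un-eq | pr-eq rewrite ≡ᵇ-refl k | un-eq | sym pr-eq =
        signedIndicator-swap (valid F ∧ remaining F) (suc a) (countUn F n) (countPr G 1)

    signedWeight-τ : ∀ F → F ∈ fillings L β → signedWeight (τ k l F) ≡ - signedWeight F
    signedWeight-τ F F∈ with valid-τ k l F∈
    ... | valid≡ with findCorner lowestIn (region k l F)
    ... | inj₁ (c , (i , cell , _) , _) with cell-swap k l F∈ {i} {c} cell
    ... | e , hat≡e , swap = signedWeight-swap swap valid≡ λ q → count-modifyCell q (toggle n) F i c hat≡e
    -- Here τ fixes F, so its weight has to be 0: F contains neither x nor y and contributes nothing
    -- in the positive degree a + 1.
    signedWeight-τ F F∈ | valid≡ | inj₂ none = trans weight≡0 (cong -_ (sym weight≡0))
      where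
      empty : All (All (Outside n)) F
      empty = hat-All⁻ F λ i c → non-cell-outside k l F∈ {i} {c} (none c i)

      no-un : ∀ {e} → Outside n e → (un n =L e) ≡ false
      no-un (low a<n) = ≢⇒≡ᵇ-false (ℕ.>⇒≢ a<n)
      no-un high = refl

      no-pr : ∀ {e} → Outside n e → (pr 1 =L e) ≡ false
      no-pr (low _) = refl
      no-pr high = refl

      weight≡0 : signedWeight F ≡ + 0
      weight≡0 = trans
        (cong₂ (signedIndicator (valid F ∧ remaining F) (suc a))
          (count-none _ (All.map (All.map no-un) empty)) (count-none _ (All.map (All.map no-pr) empty)))
        (signedIndicator-empty (valid F ∧ remaining F) a)

    hookCoeff-cancel : C (suc a) (λ i j → sgn i ℤ.* hookCoeff valid β (v ++ i ∷ []) (j ∷ u)) ≡ + 0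
    hookCoeff-cancel = begin
      C (suc a) (λ i j → sgn i ℤ.* hookCoeff valid β (v ++ i ∷ []) (j ∷ u))
        -- The alphabet depends on the number of variables but not on the exponents i and j, so all
        -- terms are sums over the same fillings.
        ≡⟨ C-cong (suc a) (λ i j _ → trans
             (cong (λ n → sgn i ℤ.* ∑ (fillings (alphabet n (suc l)) β) (hookWeight valid (v ++ i ∷ []) (j ∷ u))) (length-snoc v i))
             (sym (∑-*ˡ (sgn i) (fillings L β)))) ⟩
      C (suc a) (λ i j → ∑ (fillings L β) (λ F → sgn i ℤ.* hookWeight valid (v ++ i ∷ []) (j ∷ u) F))
        ≡⟨ C-∑ (suc a) (fillings L β) ⟩
      ∑ (fillings L β) (λ F → C (suc a) (λ i j → sgn i ℤ.* hookWeight valid (v ++ i ∷ []) (j ∷ u) F))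
        ≡⟨ ∑-cong (fillings L β) (λ F _ → C-cong (suc a) λ i j _ →
             cong (λ b → sgn i ℤ.* 𝟙 b) (hookContentOK-split (valid F) v i j u F)) ⟩
      ∑ (fillings L β) signedWeight
        ≡⟨ ∑-sign-reversing (τ-invol k l) (fillings-unique (alphabet-unique n (suc l)) β)
             (τ-∈ k l) signedWeight signedWeight-τ ⟩
      + 0 ∎
      where open ≡-Reasoning

-- Supersymmetry of the two sides and the conclusion

hsCoeff-super : ∀ μ → IsSuper (hsCoeff μ)
hsCoeff-super μ = super-cong (hsCoeff≡ μ) record
  { drop-x = hookCoeff-drop-x isSSHT μ
  ; drop-y = hookCoeff-drop-y isSSHT isSSHT-shiftPr μ
  ; cancel = λ a v u → Cancellation.hookCoeff-cancel isSSHT (λ _ → true) μ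
      (λ { {F = F} {G} _ _ swapped (lowest below) → isSSHT-preserved {F = F} {G} swapped below }) v u a
  }

hqCoeff-super : ∀ {β} → IsComposition β → IsSuper (hqCoeff β)
hqCoeff-super {β} 0<β = super-cong (hqCoeff≡ β) record
  { drop-x = hookCoeff-drop-x isHCT β
  ; drop-y = hookCoeff-drop-y isHCT isHCT-shiftPr β
  ; cancel = λ a v u → Cancellation.hookCoeff-cancel isHCT (_≡ᵇ 0) β preserved v u a
  }
  where
  preserved : ∀ {n F G i c} → map length F ≡ β → map length G ≡ β →
    SwappedAt {n} i c (hat F) (hat G) →
    Extreme (λ j → MAll.All (Outside n) (hat F j c)) i (c ≡ᵇ 0) →
    isHCT F ≡ true → isHCT G ≡ true
  -- In the leftmost column the cell is never the first entry of a triple, so only the column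
  -- condition matters; in any other column it is the reverse.
  preserved {c = zero} refl G-shape swapped (lowest below) =
    isHCT-preserved swapped 0<β (subst IsComposition (sym G-shape) 0<β) (λ _ → below) (λ _ ())
  preserved {c = suc c} refl G-shape swapped (highest above) =
    isHCT-preserved swapped 0<β (subst IsComposition (sym G-shape) 0<β) (λ ()) (λ _ _ → above)

-- The parts are letters of `range1 d`, hence positive, so `hqCoeff-super` applies to every β in the
-- sum.
∈-compositionsOf : ∀ d {β} → β ∈ compositionsOf d → IsComposition β
∈-compositionsOf d β∈
  with Mem.∈-concatMap⁻ (words (range1 d)) {xs = upTo (suc d)} (proj₁ (Mem.∈-filter⁻ (T? ∘ λ β → sum β ≡ᵇ d) {xs = concatMap (words (range1 d)) (upTo (suc d))} β∈))
... | p∈ with find p∈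
... | p , _ , β∈words = All.map positive (proj₂ (∈-words⁻ (range1 d) p β∈words))
  where
  positive : ∀ {i} → i ∈ range1 d → 0 < i
  positive i∈ with Mem.∈-map⁻ suc i∈
  ... | _ , _ , refl = s≤s z≤n

module _ (α μ : List ℕ) where

  private
    shapes : ℕ → List (List ℕ)
    shapes d = filterᵇ (α ⊆ᵇ_) (compositionsOf d)

  prodHQ≡ : ∀ v u → prodHQ α μ v u ≡ S v (λ v₁ v₂ → S u (λ u₁ u₂ → hqCoeff α v₁ u₁ ℤ.* hsCoeff μ v₂ u₂))
  prodHQ≡ v u = trans (sumℤ-concatMap _ (splits v))
    (∑-cong (splits v) λ { (v₁ , v₂) _ → trans (sumℤ-map _ (splits u)) (∑-cong (splits u) λ { (u₁ , u₂) _ → refl }) })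

  sumHQ≡ : ∀ A v u → sumHQ α A v u ≡ ∑ (shapes (sum v + sum u)) (λ β → A β ℤ.* hqCoeff β v u)
  sumHQ≡ A v u = sumℤ-map _ (shapes (sum v + sum u))

  prodHQ-super : IsComposition α → IsSuper (prodHQ α μ)
  prodHQ-super 0<α = super-cong prodHQ≡ (*-super (hqCoeff-super 0<α) (hsCoeff-super μ))

  sumHQ-super : ∀ A → IsSuper (sumHQ α A)
  sumHQ-super A = super-cong (sumHQ≡ A) (∑-super shapes A hqCoeff λ d β β∈ →
    hqCoeff-super (∈-compositionsOf d (proj₁ (Mem.∈-filter⁻ (T? ∘ (α ⊆ᵇ_)) {xs = compositionsOf d} β∈))))

  prodHQ-unprimed : ∀ v → prodHQ α μ v [] ≡ prodCS α μ v
  prodHQ-unprimed v = trans (prodHQ≡ v []) (trans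
    (∑-cong (splits v) λ { (v₁ , v₂) _ → trans (S-[] _) (cong₂ ℤ._*_ (hqCoeff-unprimed α v₁) (hsCoeff-unprimed μ v₂)) })
    (sym (sumℤ-map _ (splits v))))

  sumHQ-unprimed : ∀ A v → sumHQ α A v [] ≡ sumCS α A v
  sumHQ-unprimed A v = trans (sumHQ≡ A v []) (trans
    (cong (λ d → ∑ (shapes d) (λ β → A β ℤ.* hqCoeff β v [])) (ℕ.+-identityʳ (sum v)))
    (trans (∑-cong (shapes (sum v)) λ β _ → cong (A β ℤ.*_) (hqCoeff-unprimed β v))
      (sym (sumℤ-map _ (shapes (sum v))))))

theorem7p2 : (α μ : List ℕ) (A : List ℕ → ℤ) → IsComposition α → IsPartition μ →
    (∀ (v : List ℕ) → prodCS α μ v ≡ sumCS α A v) →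
    ∀ (k l : ℕ) (v : Vec ℕ k) (u : Vec ℕ l) →
    prodHQ α μ (toList v) (toList u) ≡ sumHQ α A (toList v) (toList u)
theorem7p2 α μ A 0<α _ CS-identity k l v u =
  super-unique (prodHQ-super α μ 0<α) (sumHQ-super α μ A)
    (λ v → trans (prodHQ-unprimed α μ v) (trans (CS-identity v) (sym (sumHQ-unprimed α μ A v))))
    (toList u) (toList v)
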